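{- Let $\mathbb{K}$ be a field of characteristic $0$, let $F(n)$ be a holonomic sequence over $\mathbb{K}$, and let $L=\sum_{i=0}^{J}a_i(n)\sigma^i\in\operatorname{ann}F(n)$ be a nonzero operator. Then there exists a nonzero polynomial $p(n)\in\mathbb{K}[n]$ such that $p(n)F(n)$ is summable and \[\deg p(n)\le \deg L + C_L,\] where $\deg L$ is the degree of $L$ and $C_L$ is the continued zero index of $L$.
   Context: $\sigma$ is the shift operator, $\sigma(F(n))=F(n+1)$, and for $L=\sum_{i=0}^J a_i(n)\sigma^i\in\mathbb{K}[n][\sigma]$, $L(F(n))=\sum_{i=0}^J a_i(n)F(n+i)$. The annihilator is $\operatorname{ann}F(n)=\{L\in\mathbb{K}[n][\sigma]: L(F(n))=0\}$; $F$ is holonomic if $\operatorname{ann}F(n)\ne\{0\}$. The order $\operatorname{ord}F(n)$ is the minimal order $J$ of a nonzero element of $\operatorname{ann}F(n)$. A holonomic sequence $G(n)$ of order $J$ is summable if $G(n)=\Delta\big(\sum_{i=0}^{J-1}u_i(n)G(n+i)\big)$ for some rational functions $u_i(n)\in\mathbb{K}(n)$, where $\Delta=\sigma-1$. The adjoint of $L$ acts on polynomials by $L^*(x(n))=\sum_{i=0}^J a_i(n-i)x(n-i)$. Degree of $L$: put $b_k(n)=\sum_{j=k}^{J}\binom{j}{k}a_{J-j}(n+j-J)$ for $0\le k\le J$, and $\deg L=\max_{0\le k\le J}\{\deg b_k(n)-k\}$. Continued zero index $C_L$: if $L^*(1)\neq0$ then $C_L=0$; if $L^*(1)=0$ then $C_L$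 is the positive integer with $L^*(n^{C_L})\neq 0$ and $L^*(n^i)=0$ for $0\le i\le C_L-1$.
   Formalization: Sequences are indexed by n ≥ 0 and summability is required only for all sufficiently large n, since the rational u_i may have poles; for all n the claim fails, e.g. F = δ_{n,0}, L = σ (p constant, pF of order 0 but nonzero). -}

module Defs where

open import Level using (Level; _⊔_)
open import Algebra.Apartness.Bundles using (HeytingField; HeytingCommutativeRing)
open import Algebra.Bundles using (CommutativeRing)
import Algebra.Definitions.RawMonoid as RawMonoidDefs
open import Data.Fin.Base as Fin using (Fin; toℕ; opposite)
open import Data.Integer.Base as ℤ using (ℤ; +_)
open import Data.List.Base using (List; []; _∷_; _++_; map; replicate)
open import Data.Nat.Base as ℕ using (ℕ; zero; suc)
open import Data.Nat.Combinatorics using (_C_)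
open import Data.Product.Base using (Σ-syntax; _×_; proj₁)
open import Data.Vec.Functional as Vector using (Vector)
open import Relation.Binary.PropositionalEquality using (_≡_)
open import Relation.Nullary.Negation using (¬_)

-- Under excluded middle the apartness of a Heyting field is just inequality
-- (by tightness), so `HeytingField` together with excluded middle is exactly
-- the classical notion of field.
module Holonomic {c ℓ₁ ℓ₂ : Level} (K : HeytingField c ℓ₁ ℓ₂) where

  open HeytingField K using
    (Carrier; _≈_; _#_; _+_; _*_; _-_; 0#; 1#; #⇒invertible; heytingCommutativeRing)
  open CommutativeRing (HeytingCommutativeRing.commutativeRing heytingCommutativeRing)
    using (+-rawMonoid)
  open RawMonoidDefs +-rawMonoid using (sum) renaming (_×_ to _×ᴷ_)

  ι : ℕ → Carrier
  ι n = n ×ᴷ 1#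

  CharacteristicZero : Set ℓ₁
  CharacteristicZero = ∀ n → ¬ (ι (suc n) ≈ 0#)

  -- Coefficients, constant term first; trailing zeros are allowed, so equality
  -- with 0 and degree are expressed through `coeff`.
  Poly : Set c
  Poly = List Carrier

  coeff : Poly → ℕ → Carrier
  coeff []      _       = 0#
  coeff (a ∷ p) zero    = a
  coeff (a ∷ p) (suc i) = coeff p i

  IsZero : Poly → Set ℓ₁
  IsZero p = ∀ i → coeff p i ≈ 0#

  HasDegree : Poly → ℕ → Set ℓ₁
  HasDegree p d = ¬ (coeff p d ≈ 0#) × (∀ i → d ℕ.< i → coeff p i ≈ 0#)

  eval : Poly → Carrier → Carrier
  eval []      x = 0#
  eval (a ∷ p) x = a + x * eval p x

  infixl 6 _+ₚ_
  infixl 7 _*ₚ_ _·ₚ_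

  _+ₚ_ : Poly → Poly → Poly
  []      +ₚ q       = q
  (a ∷ p) +ₚ []      = a ∷ p
  (a ∷ p) +ₚ (b ∷ q) = (a + b) ∷ (p +ₚ q)

  _·ₚ_ : Carrier → Poly → Poly
  a ·ₚ p = map (a *_) p

  _*ₚ_ : Poly → Poly → Poly
  []      *ₚ q = []
  (a ∷ p) *ₚ q = (a ·ₚ q) +ₚ (0# ∷ (p *ₚ q))

  sumₚ : ∀ {m} → Vector Poly m → Poly
  sumₚ = Vector.foldr _+ₚ_ []

  -- n ^ k
  mono : ℕ → Poly
  mono k = replicate k 0# ++ (1# ∷ [])

  -- translate e p is p(n + e).
  translate : Carrier → Poly → Poly
  translate e []      = []
  translate e (a ∷ p) = (a ∷ []) +ₚ (e ∷ 1# ∷ []) *ₚ translate e p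

  -- Fractions need not be in lowest terms.
  record RatFun : Set (c ⊔ ℓ₁) where
    field
      num   : Poly
      den   : Poly
      den≉0 : ¬ IsZero den

  open RatFun public

  DefinedAt : RatFun → Carrier → Set ℓ₂
  DefinedAt u x = eval (den u) x # 0#

  valueAt : (u : RatFun) (x : Carrier) → DefinedAt u x → Carrier
  valueAt u x d = eval (num u) x * proj₁ (#⇒invertible d)

  -- a : Op J is a₀(n) + a₁(n) σ + ⋯ + a_J(n) σ^J; the coefficient a_J may vanish.
  Op : ℕ → Set c
  Op J = Vector Poly (suc J)

  IsZeroOp : ∀ {J} → Op J → Set ℓ₁
  IsZeroOp a = ∀ i → IsZero (a i)

  HasOrder : ∀ {J} → Op J → ℕ → Set ℓ₁
  HasOrder {J} a r =
    Σ[ i ∈ Fin (suc J) ] toℕ i ≡ r × ¬ IsZero (a i) × (∀ j → i Fin.< j → IsZero (a j))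

  Sequence : Set c
  Sequence = ℕ → Carrier

  apply : ∀ {J} → Op J → Sequence → Sequence
  apply a F n = sum λ i → eval (a i) (ι n) * F (n ℕ.+ toℕ i)

  infix 4 _∈ann_
  _∈ann_ : ∀ {J} → Op J → Sequence → Set ℓ₁
  a ∈ann F = ∀ n → apply a F n ≈ 0#

  -- L*(x) = ∑ᵢ aᵢ(n - i) x(n - i)
  adjoint : ∀ {J} → Op J → Poly → Poly
  adjoint a x = sumₚ λ i →
    translate (0# - ι (toℕ i)) (a i) *ₚ translate (0# - ι (toℕ i)) x

  -- b_k(n) = ∑_{j=k}^{J} binom(j,k) a_{J-j}(n + j - J); the terms with j < k are
  -- included but vanish, since then j C k = 0.
  bPoly : ∀ {J} → Op J → ℕ → Poly
  bPoly {J} a k = sumₚ λ (j : Fin (suc J)) →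
    ι (toℕ j C k) ·ₚ translate (ι (toℕ j) - ι J) (a (opposite j))

  -- D = max_{0≤k≤J} (deg b_k - k), where deg 0 = -∞: the zero b_k have no
  -- `HasDegree` and so do not contribute.
  HasOpDegree : ∀ {J} → Op J → ℤ → Set ℓ₁
  HasOpDegree {J} a D =
    (Σ[ k ∈ ℕ ] Σ[ d ∈ ℕ ] k ℕ.≤ J × HasDegree (bPoly a k) d × D ≡ + d ℤ.- + k) ×
    (∀ k d → k ℕ.≤ J → HasDegree (bPoly a k) d → + d ℤ.- + k ℤ.≤ D)

  -- For C = 0 this says L*(1) ≠ 0; for C > 0 it includes L*(1) = 0.
  HasContinuedZeroIndex : ∀ {J} → Op J → ℕ → Set ℓ₁
  HasContinuedZeroIndex a C =
    ¬ IsZero (adjoint a (mono C)) × (∀ i → i ℕ.< C → IsZero (adjoint a (mono i)))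

  IsHolonomic : Sequence → Set (c ⊔ ℓ₁)
  IsHolonomic F = Σ[ J ∈ ℕ ] Σ[ a ∈ Op J ] ¬ IsZeroOp a × a ∈ann F

  HasSeqOrder : Sequence → ℕ → Set (c ⊔ ℓ₁)
  HasSeqOrder F r =
    (Σ[ J ∈ ℕ ] Σ[ a ∈ Op J ] a ∈ann F × HasOrder a r) ×
    (∀ J (a : Op J) s → a ∈ann F → HasOrder a s → r ℕ.≤ s)

  -- G(n) = Δ(∑_{i<r} uᵢ(n) G(n+i)) with r the (minimal) order of G. The rational
  -- functions uᵢ may have poles at natural numbers, so, as usual when rational
  -- functions act on sequences, the identity is one of germs at infinity: from
  -- some N on, no uᵢ has a pole and the two sides agree.
  IsSummable : Sequence → Set (c ⊔ ℓ₁ ⊔ ℓ₂)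
  IsSummable G =
    Σ[ r ∈ ℕ ] HasSeqOrder G r ×
    (Σ[ u ∈ Vector RatFun r ] Σ[ N ∈ ℕ ]
     Σ[ def ∈ (∀ n → N ℕ.≤ n → ∀ i → DefinedAt (u i) (ι n)) ]
     let S : ∀ n → N ℕ.≤ n → Carrier
         S n N≤n = sum λ i → valueAt (u i) (ι n) (def n N≤n i) * G (n ℕ.+ toℕ i)
     in ∀ n (N≤n : N ℕ.≤ n) (N≤1+n : N ℕ.≤ suc n) → G n ≈ S (suc n) N≤1+n - S n N≤n)

  infixl 7 _⊙_
  _⊙_ : Poly → Sequence → Sequence
  (p ⊙ F) n = eval p (ι n) * F n

{-# OPTIONS --safe #-}
module Submission where

-- Take p = L*(n^C) with C the continued zero index. Lagrange's identity exhibits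
-- x L(F) - L*(x) F as the difference of a polynomial combination of shifts of F, so
-- p F = L*(n^C) F is a difference; dividing by shifts of p and reducing by a minimal
-- recurrence of p F turns it into a rational combination of the first r shifts of p F.
-- For the degree, σ = 1 + Δ gives L*(x) = ∑ₖ bₖ Δᵏ(x(n - J)), and Δ lowers degrees.
-- Polynomials are compared through their values at the natural numbers, since in
-- characteristic 0 a nonzero polynomial has no natural root from some point on.

open import Defs
open import Level using (Level; _⊔_; Lift; lift; lower)
open import Algebra.Apartness.Bundles using (HeytingField; HeytingCommutativeRing)
open import Algebra.Bundles using (CommutativeRing)
open import Axiom.ExcludedMiddle using (ExcludedMiddle)
open import Data.Fin.Base as Fin using (Fin; zero; suc; toℕ; opposite; punchIn)
import Data.Fin.Permutation as Perm
import Data.Fin.Properties as Finₚ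
open import Data.Integer.Base as ℤ using (ℤ; +_)
import Data.Integer.Properties as ℤₚ
open import Data.Integer.Tactic.RingSolver using (solve-∀)
open import Data.List.Base using ([]; _∷_; length)
open import Data.Nat.Base as ℕ using (ℕ; zero; suc; z≤n; s≤s)
open import Data.Nat.Combinatorics using (_C_; nCn≡1; nCk≡nC[n∸k]; nCk+nC[k+1]≡[n+1]C[k+1])
open import Data.Nat.Induction using (<-rec)
import Data.Nat.Properties as ℕₚ
open import Data.Product.Base using (Σ-syntax; ∃-syntax; _×_; _,_; proj₁; proj₂)
open import Data.Sum.Base using (_⊎_; inj₁; inj₂)
open import Data.Vec.Functional as Vector using (Vector; removeAt)
open import Function.Base using (_∘_)
open import Relation.Binary.PropositionalEquality as ≡ using (_≡_)
open import Relation.Binary.Definitions using (tri<; tri≈; tri>)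
open import Relation.Nullary.Decidable using (yes; no; map′; decidable-stable)
open import Relation.Nullary.Negation using (¬_; contradiction)

-- The adjoint raises degrees by at most deg L, so among monomials the first one that it does not
-- kill gives the smallest bound obtainable this way, and that monomial has degree C_L. Its
-- existence needs an argument: a nonzero `L` must have a nonzero adjoint. This is shown by testing
-- the adjoint on polynomials with prescribed roots, and it also gives deg L a value, since the
-- adjoint would be zero if every b_k were. The obstacle is in the word summable. It asks for a
-- combination of the first r shifts of p F, with r the minimal order of p F, whereas Lagrange's
-- identity produces shifts of F, as many as the given `L` dictates, and `L` need not be minimal.
-- Hence the shifts of F are first rewritten through p F, and then reduced by an annihilator of p F
-- of order r. That p F has an annihilator at all follows from `L` by clearing denominators. These
-- divisions may fail at finitely many n, so combinations are kept over a common denominator and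
-- hold only from some index on.

lower-em : ∀ {a b} → ExcludedMiddle (a ⊔ b) → ExcludedMiddle a
lower-em {b = b} em {P} = map′ lower lift (em {Lift b P})

¬∀⇒∃¬ : ∀ {a p} → ExcludedMiddle (a ⊔ p) → {A : Set a} {P : A → Set p} →
        ¬ (∀ x → P x) → Σ[ x ∈ A ] ¬ P x
¬∀⇒∃¬ {a} {p} em {A} {P} ¬∀ with em {Σ[ x ∈ A ] ¬ P x}
... | yes found = found
... | no  ¬∃   = contradiction all ¬∀
  where
  all : ∀ x → P x
  all x with lower-em {p} {a} em {P x}
  ... | yes px = px
  ... | no ¬px = contradiction (x , ¬px) ¬∃

<-suc-elim : ∀ {p n} (P : ℕ → Set p) → (∀ k → k ℕ.< n → P k) → P n → ∀ k → k ℕ.< suc n → P k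
<-suc-elim P below Pn k k<1+n with ℕₚ.m≤n⇒m<n∨m≡n (ℕ.s≤s⁻¹ k<1+n)
... | inj₁ k<n    = below k k<n
... | inj₂ ≡.refl = Pn

least : ∀ {p} → ExcludedMiddle p → {P : ℕ → Set p} → ∃[ n ] P n →
        ∃[ n ] P n × (∀ m → m ℕ.< n → ¬ P m)
least em {P} (n , Pn) with search (suc n)
  where
  search : ∀ k → (∃[ n ] P n × (∀ m → m ℕ.< n → ¬ P m)) ⊎ (∀ m → m ℕ.< k → ¬ P m)
  search zero = inj₂ λ _ ()
  search (suc k) with search k
  ... | inj₁ found = inj₁ found
  ... | inj₂ below with em {P k}
  ...   | yes Pk = inj₁ (k , Pk , below)
  ...   | no ¬Pk = inj₂ (<-suc-elim (λ m → ¬ P m) below ¬Pk)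
... | inj₁ found = found
... | inj₂ none  = contradiction Pn (none n ℕₚ.≤-refl)

-- Arithmetic of degree inequalities and binomial coefficients.

-- If both alternatives failed, adding the reversed inequalities would contradict the hypothesis. In
-- `bound-*` the alternatives say which factor of a product of coefficients vanishes.
sum-< : ∀ m m′ k i k′ → m ℕ.+ m′ ℕ.< i ℕ.+ (k ℕ.+ k′) → m ℕ.< k ⊎ m′ ℕ.< i ℕ.+ k′
sum-< m m′ k i k′ lt with m′ ℕₚ.<? i ℕ.+ k′
... | yes m′<i+k′ = inj₂ m′<i+k′
... | no  m′≮i+k′ = inj₁ (ℕₚ.+-cancelʳ-< (i ℕ.+ k′) m k (begin
  suc (m ℕ.+ (i ℕ.+ k′))  ≤⟨ s≤s (ℕₚ.+-monoʳ-≤ m (ℕₚ.≮⇒≥ m′≮i+k′)) ⟩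
  suc (m ℕ.+ m′)          ≤⟨ lt ⟩
  i ℕ.+ (k ℕ.+ k′)        ≡⟨ x∙yz≈y∙xz i k k′ ⟩
  k ℕ.+ (i ℕ.+ k′)        ∎))
  where
  open ℕₚ.≤-Reasoning
  open import Algebra.Properties.CommutativeSemigroup ℕₚ.+-commutativeSemigroup using (x∙yz≈y∙xz)

nC0≡1 : ∀ n → n C 0 ≡ 1
nC0≡1 n = ≡.trans (nCk≡nC[n∸k] {0} {n} z≤n) (nCn≡1 n)

-- This and its counterpart below pass between operator degrees, which are integers and may be
-- negative, and the subtraction-free inequalities of `DegreeBound`.
-≤-⇒+≤+ : ∀ a b c d → + a ℤ.- + b ℤ.≤ + c ℤ.- + d → a ℕ.+ d ℕ.≤ c ℕ.+ b
-≤-⇒+≤+ a b c d le = ℤₚ.drop‿+≤+ (≡.subst₂ ℤ._≤_ (left (+ a) (+ b) (+ d)) (right (+ c) (+ b) (+ d))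
  (ℤₚ.+-monoˡ-≤ (+ b ℤ.+ + d) le))
  where
  left : ∀ a b d → a ℤ.- b ℤ.+ (b ℤ.+ d) ≡ a ℤ.+ d
  left = solve-∀
  right : ∀ c b d → c ℤ.- d ℤ.+ (b ℤ.+ d) ≡ c ℤ.+ b
  right = solve-∀

+≤+⇒≤-+ : ∀ a c d s → a ℕ.+ d ℕ.≤ c ℕ.+ s → + a ℤ.≤ + c ℤ.- + d ℤ.+ + s
+≤+⇒≤-+ a c d s le = ≡.subst₂ ℤ._≤_ (left (+ a) (+ d)) (right (+ c) (+ d) (+ s))
  (ℤₚ.+-monoˡ-≤ (ℤ.- + d) (ℤ.+≤+ le))
  where
  left : ∀ a d → a ℤ.+ d ℤ.- d ≡ a
  left = solve-∀
  right : ∀ c d s → c ℤ.+ s ℤ.- d ≡ c ℤ.- d ℤ.+ s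
  right = solve-∀

-- Evaluation and coefficients of polynomials; synthetic division.

module Polynomials {c ℓ₁ ℓ₂ : Level} (K : HeytingField c ℓ₁ ℓ₂) where

  open Holonomic K
  open HeytingField K using (heytingCommutativeRing)

  R : CommutativeRing c ℓ₁
  R = HeytingCommutativeRing.commutativeRing heytingCommutativeRing

  open CommutativeRing R hiding (zero)
  open import Algebra.Properties.Semiring.Sum semiring
    using (sum; sum-cong-≋; sum-remove; sum-permute; ∑-distrib-+; ∑-comm; *-distribˡ-sum; *-distribʳ-sum)
  open import Algebra.Properties.Semiring.Mult semiring using (×-homo-+; ×-congˡ)
  open import Algebra.Properties.Ring ring using (-‿distribˡ-*; -0#≈0#)
  open import Relation.Binary.Reasoning.Setoid setoid
  open import Algebra.Properties.CommutativeSemigroup *-commutativeSemigroup using (x∙yz≈y∙xz)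
  open import Algebra.Solver.Ring.NaturalCoefficients.Default commutativeSemiring
    using (solve; con; _:+_; _:*_; _:=_)

  x-y+y : ∀ x y → (x - y) + y ≈ x
  x-y+y x y = begin
    (x - y) + y    ≈⟨ +-assoc x (- y) y ⟩
    x + (- y + y)  ≈⟨ +-congˡ (-‿inverseˡ y) ⟩
    x + 0#         ≈⟨ +-identityʳ x ⟩
    x              ∎

  x-y≈0⇒x≈y : ∀ {x y} → x - y ≈ 0# → x ≈ y
  x-y≈0⇒x≈y {x} {y} eq = begin
    x            ≈⟨ x-y+y x y ⟨
    (x - y) + y  ≈⟨ +-congʳ eq ⟩
    0# + y       ≈⟨ +-identityˡ y ⟩
    y            ∎

  0+0 : ∀ {x y} → x ≈ 0# → y ≈ 0# → x + y ≈ 0#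
  0+0 x≈0 y≈0 = trans (+-cong x≈0 y≈0) (+-identityˡ 0#)

  *0 : ∀ {x y} → y ≈ 0# → x * y ≈ 0#
  *0 y≈0 = trans (*-congˡ y≈0) (zeroʳ _)

  0* : ∀ {x y} → x ≈ 0# → x * y ≈ 0#
  0* x≈0 = trans (*-congʳ x≈0) (zeroˡ _)

  sum-zero : ∀ {n} {t : Vector Carrier n} → (∀ i → t i ≈ 0#) → sum t ≈ 0#
  sum-zero {zero}  t≈0 = refl
  sum-zero {suc n} t≈0 = 0+0 (t≈0 zero) (sum-zero (t≈0 ∘ suc))

  ι-+ : ∀ m n → ι (m ℕ.+ n) ≈ ι m + ι n
  ι-+ = ×-homo-+ 1#

  ι-cong : ∀ {m n} → m ≡ n → ι m ≈ ι n
  ι-cong = ×-congˡ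

  eval-cong : ∀ p {x y} → x ≈ y → eval p x ≈ eval p y
  eval-cong []      x≈y = refl
  eval-cong (a ∷ p) x≈y = +-congˡ (*-cong x≈y (eval-cong p x≈y))

  eval-+ : ∀ p q x → eval (p +ₚ q) x ≈ eval p x + eval q x
  eval-+ []      q       x = sym (+-identityˡ _)
  eval-+ (a ∷ p) []      x = sym (+-identityʳ _)
  eval-+ (a ∷ p) (b ∷ q) x = begin
    (a + b) + x * eval (p +ₚ q) x             ≈⟨ +-congˡ (*-congˡ (eval-+ p q x)) ⟩
    (a + b) + x * (eval p x + eval q x)       ≈⟨ rearrange a b x (eval p x) (eval q x) ⟩
    (a + x * eval p x) + (b + x * eval q x)   ∎
    where
    rearrange : ∀ a b x u v → (a + b) + x * (u + v) ≈ (a + x * u) + (b + x * v)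
    rearrange = solve 5 (λ a b x u v →
      ((a :+ b) :+ x :* (u :+ v)) := ((a :+ x :* u) :+ (b :+ x :* v))) refl

  eval-· : ∀ a p x → eval (a ·ₚ p) x ≈ a * eval p x
  eval-· a []      x = sym (zeroʳ a)
  eval-· a (b ∷ p) x = begin
    a * b + x * eval (a ·ₚ p) x  ≈⟨ +-congˡ (*-congˡ (eval-· a p x)) ⟩
    a * b + x * (a * eval p x)   ≈⟨ rearrange a b x (eval p x) ⟩
    a * (b + x * eval p x)       ∎
    where
    rearrange : ∀ a b x u → a * b + x * (a * u) ≈ a * (b + x * u)
    rearrange = solve 4 (λ a b x u → (a :* b :+ x :* (a :* u)) := (a :* (b :+ x :* u))) refl

  eval-* : ∀ p q x → eval (p *ₚ q) x ≈ eval p x * eval q x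
  eval-* []      q x = sym (zeroˡ _)
  eval-* (a ∷ p) q x = begin
    eval (a ·ₚ q +ₚ (0# ∷ p *ₚ q)) x               ≈⟨ eval-+ (a ·ₚ q) (0# ∷ p *ₚ q) x ⟩
    eval (a ·ₚ q) x + (0# + x * eval (p *ₚ q) x)   ≈⟨ +-cong (eval-· a q x) (+-identityˡ _) ⟩
    a * eval q x + x * eval (p *ₚ q) x             ≈⟨ +-congˡ (*-congˡ (eval-* p q x)) ⟩
    a * eval q x + x * (eval p x * eval q x)       ≈⟨ rearrange a x (eval p x) (eval q x) ⟩
    (a + x * eval p x) * eval q x                  ∎
    where
    rearrange : ∀ a x u v → a * v + x * (u * v) ≈ (a + x * u) * v
    rearrange = solve 4 (λ a x u v → (a :* v :+ x :* (u :* v)) := ((a :+ x :* u) :* v)) refl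

  eval-const : ∀ a x → eval (a ∷ []) x ≈ a
  eval-const a x = trans (+-congˡ (zeroʳ x)) (+-identityʳ a)

  eval-linear : ∀ e x → eval (e ∷ 1# ∷ []) x ≈ x + e
  eval-linear e x = begin
    e + x * eval (1# ∷ []) x  ≈⟨ +-congˡ (*-congˡ (eval-const 1# x)) ⟩
    e + x * 1#                ≈⟨ +-congˡ (*-identityʳ x) ⟩
    e + x                     ≈⟨ +-comm e x ⟩
    x + e                     ∎

  eval-translate : ∀ e p x → eval (translate e p) x ≈ eval p (x + e)
  eval-translate e []      x = refl
  eval-translate e (a ∷ p) x = begin
    eval ((a ∷ []) +ₚ (e ∷ 1# ∷ []) *ₚ translate e p) x
      ≈⟨ eval-+ (a ∷ []) ((e ∷ 1# ∷ []) *ₚ translate e p) x ⟩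
    eval (a ∷ []) x + eval ((e ∷ 1# ∷ []) *ₚ translate e p) x
      ≈⟨ +-cong (eval-const a x) (eval-* (e ∷ 1# ∷ []) (translate e p) x) ⟩
    a + eval (e ∷ 1# ∷ []) x * eval (translate e p) x
      ≈⟨ +-congˡ (*-cong (eval-linear e x) (eval-translate e p x)) ⟩
    a + (x + e) * eval p (x + e) ∎

  eval-sum : ∀ {m} (v : Vector Poly m) x → eval (sumₚ v) x ≈ sum λ i → eval (v i) x
  eval-sum {zero}  v x = refl
  eval-sum {suc m} v x = trans (eval-+ (v zero) _ x) (+-congˡ (eval-sum (v ∘ suc) x))

  IsZero⇒eval≈0 : ∀ p → IsZero p → ∀ x → eval p x ≈ 0#
  IsZero⇒eval≈0 []      p≈0 x = refl
  IsZero⇒eval≈0 (a ∷ p) p≈0 x = 0+0 (p≈0 0) (*0 (IsZero⇒eval≈0 p (p≈0 ∘ suc) x))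

  coeff-+ : ∀ p q i → coeff (p +ₚ q) i ≈ coeff p i + coeff q i
  coeff-+ []      q       i       = sym (+-identityˡ _)
  coeff-+ (a ∷ p) []      i       = sym (+-identityʳ _)
  coeff-+ (a ∷ p) (b ∷ q) zero    = refl
  coeff-+ (a ∷ p) (b ∷ q) (suc i) = coeff-+ p q i

  coeff-· : ∀ a p i → coeff (a ·ₚ p) i ≈ a * coeff p i
  coeff-· a []      i       = sym (zeroʳ a)
  coeff-· a (b ∷ p) zero    = refl
  coeff-· a (b ∷ p) (suc i) = coeff-· a p i

  infixl 6 _-ₚ_
  _-ₚ_ : Poly → Poly → Poly
  p -ₚ q = p +ₚ (- 1#) ·ₚ q

  -1*x≈-x : ∀ x → - 1# * x ≈ - x
  -1*x≈-x x = trans (sym (-‿distribˡ-* 1# x)) (-‿cong (*-identityˡ x))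

  eval-- : ∀ p q x → eval (p -ₚ q) x ≈ eval p x - eval q x
  eval-- p q x = trans (eval-+ p _ x) (+-congˡ (trans (eval-· (- 1#) q x) (-1*x≈-x _)))

  coeff-- : ∀ p q i → coeff (p -ₚ q) i ≈ coeff p i - coeff q i
  coeff-- p q i = trans (coeff-+ p _ i) (+-congˡ (trans (coeff-· (- 1#) q i) (-1*x≈-x _)))

  -- The quotient of a + n p(n) by n - c.
  quotient : Carrier → Poly → Poly
  quotient c []      = []
  quotient c (b ∷ p) = eval (b ∷ p) c ∷ quotient c p

  -- Horner's scheme: the partial values at `c` are the coefficients of the quotient, and the last
  -- one is the remainder.
  quotient-correct : ∀ c a p x →
    eval (a ∷ p) x ≈ (x - c) * eval (quotient c p) x + eval (a ∷ p) c
  quotient-correct c a []      x = begin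
    a + x * 0#                        ≈⟨ eval-const a x ⟩
    a                                 ≈⟨ eval-const a c ⟨
    a + c * 0#                        ≈⟨ +-identityˡ _ ⟨
    0# + (a + c * 0#)                 ≈⟨ +-congʳ (zeroʳ _) ⟨
    (x - c) * 0# + (a + c * 0#)       ∎
  quotient-correct c a (b ∷ p) x = begin
    a + x * eval (b ∷ p) x                     ≈⟨ +-congˡ (*-congˡ (quotient-correct c b p x)) ⟩
    -- Writing `x` as `y + c` leaves an identity free of subtraction, as the semiring solver
    -- requires.
    a + x * (y * q + e)                        ≈⟨ +-congˡ (*-congʳ (x-y+y x c)) ⟨
    a + (y + c) * (y * q + e)                  ≈⟨ rearrange a y c q e ⟩
    y * (e + (y + c) * q) + (a + c * e)        ≈⟨ +-congʳ (*-congˡ (+-congˡ (*-congʳ (x-y+y x c)))) ⟩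
    y * (e + x * q) + (a + c * e)              ∎
    where
    y = x - c
    q = eval (quotient c p) x
    e = eval (b ∷ p) c
    rearrange : ∀ a y c q e → a + (y + c) * (y * q + e) ≈ y * (e + (y + c) * q) + (a + c * e)
    rearrange = solve 5 (λ a y c q e →
      (a :+ (y :+ c) :* (y :* q :+ e)) := (y :* (e :+ (y :+ c) :* q) :+ (a :+ c :* e))) refl

  length-quotient : ∀ c p → length (quotient c p) ≡ length p
  length-quotient c []      = ≡.refl
  length-quotient c (b ∷ p) = ≡.cong suc (length-quotient c p)

  constant-term≈0 : ∀ {a c} p → eval (a ∷ p) c ≈ 0# → IsZero p → a ≈ 0#
  constant-term≈0 {a} {c} p root p≈0 = begin
    a               ≈⟨ +-identityʳ a ⟨
    a + 0#          ≈⟨ +-congˡ (*0 (IsZero⇒eval≈0 p p≈0 c)) ⟨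
    eval (a ∷ p) c  ≈⟨ root ⟩
    0#              ∎

  IsZero-∷ : ∀ {a p} → a ≈ 0# → IsZero p → IsZero (a ∷ p)
  IsZero-∷ a≈0 p≈0 zero    = a≈0
  IsZero-∷ a≈0 p≈0 (suc i) = p≈0 i

  -- The quotient depends on the coefficients of `p` by a triangular system with ones on the
  -- diagonal, so vanishing propagates from the highest coefficient down.
  quotient≈0⇒tail≈0 : ∀ c p → IsZero (quotient c p) → IsZero p
  quotient≈0⇒tail≈0 c []      q≈0 = λ _ → refl
  quotient≈0⇒tail≈0 c (b ∷ p) q≈0 = IsZero-∷ (constant-term≈0 p (q≈0 0) p≈0) p≈0
    where p≈0 = quotient≈0⇒tail≈0 c p (q≈0 ∘ suc)

  prodₚ : ∀ {m} → Vector Poly m → Poly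
  prodₚ = Vector.foldr _*ₚ_ (1# ∷ [])

  eval-prod-remove : ∀ {m} (v : Vector Poly (suc m)) i x →
    eval (prodₚ v) x ≈ eval (v i) x * eval (prodₚ (removeAt v i)) x
  eval-prod-remove         v zero    x = eval-* (v zero) _ x
  eval-prod-remove {suc m} v (suc i) x = begin
    eval (prodₚ v) x                          ≈⟨ eval-* (v zero) _ x ⟩
    v₀ * eval (prodₚ (v ∘ suc)) x             ≈⟨ *-congˡ (eval-prod-remove (v ∘ suc) i x) ⟩
    v₀ * (eval (v (suc i)) x * w)             ≈⟨ x∙yz≈y∙xz v₀ _ w ⟩
    eval (v (suc i)) x * (v₀ * w)             ≈⟨ *-congˡ (eval-* (v zero) _ x) ⟨
    eval (v (suc i)) x * eval (prodₚ (removeAt v (suc i))) x ∎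
    where
    v₀ = eval (v zero) x
    w = eval (prodₚ (removeAt (v ∘ suc) i)) x

  eval-prod≈0 : ∀ {m} (v : Vector Poly m) i {x} → eval (v i) x ≈ 0# → eval (prodₚ v) x ≈ 0#
  eval-prod≈0 {suc m} v i root = trans (eval-prod-remove v i _) (0* root)

  -- Field laws and nonvanishing of polynomials in characteristic 0.

  module Classical (em : ExcludedMiddle (c ⊔ ℓ₁ ⊔ ℓ₂)) (char0 : CharacteristicZero) where

    open HeytingField K using (_#_; tight; #⇒invertible)
    open import Algebra.Properties.Group +-group using (∙-cancelˡ; ∙-cancelʳ; ⁻¹-injective)

    emˡ : ExcludedMiddle ℓ₁
    emˡ = lower-em {b = c ⊔ ℓ₂} em

    ≉0⇒#0 : ∀ {x} → ¬ x ≈ 0# → x # 0#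
    ≉0⇒#0 {x} x≉0 with lower-em {b = c ⊔ ℓ₁} em {x # 0#}
    ... | yes x#0 = x#0
    ... | no ¬x#0 = contradiction (proj₁ (tight x 0#) ¬x#0) x≉0

    -- The apartness `x # 0#` provides an inverse of `x - 0#`, which has to be identified with `x`.
    inverseˡ : ∀ {x} (x#0 : x # 0#) → proj₁ (#⇒invertible x#0) * x ≈ 1#
    inverseˡ {x} x#0 = trans (*-congˡ x≈x-0) (proj₁ (proj₂ (#⇒invertible x#0)))
      where
      x≈x-0 : x ≈ x - 0#
      x≈x-0 = sym (trans (+-congˡ -0#≈0#) (+-identityʳ x))

    *-cancel-≉0 : ∀ {x y} → ¬ x ≈ 0# → x * y ≈ 0# → y ≈ 0#
    *-cancel-≉0 {x} {y} x≉0 xy≈0 = begin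
      y                ≈⟨ *-identityˡ y ⟨
      1# * y           ≈⟨ *-congʳ (inverseˡ x#0) ⟨
      (x⁻¹ * x) * y    ≈⟨ *-assoc x⁻¹ x y ⟩
      x⁻¹ * (x * y)    ≈⟨ *0 xy≈0 ⟩
      0#               ∎
      where
      x#0 = ≉0⇒#0 x≉0
      x⁻¹ = proj₁ (#⇒invertible x#0)

    *-≉0 : ∀ {x y} → ¬ x ≈ 0# → ¬ y ≈ 0# → ¬ x * y ≈ 0#
    *-≉0 x≉0 y≉0 xy≈0 = y≉0 (*-cancel-≉0 x≉0 xy≈0)

    1≉0 : ¬ 1# ≈ 0#
    1≉0 1≈0 = char0 0 (0+0 1≈0 refl)

    <⇒ι≉ι : ∀ {m n} → m ℕ.< n → ¬ ι n ≈ ι m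
    <⇒ι≉ι {m} m<n ιn≈ιm with ℕₚ.m≤n⇒∃[o]m+o≡n m<n
    ... | o , ≡.refl = char0 o (∙-cancelˡ (ι m) _ _ (begin
      ι m + ι (suc o)     ≈⟨ ι-+ m (suc o) ⟨
      ι (m ℕ.+ suc o)     ≈⟨ ι-cong (ℕₚ.+-suc m o) ⟩
      ι (suc m ℕ.+ o)     ≈⟨ ιn≈ιm ⟩
      ι m                 ≈⟨ +-identityʳ _ ⟨
      ι m + 0#            ∎))

    ι-injective : ∀ {m n} → ι m ≈ ι n → m ≡ n
    ι-injective {m} {n} eq with ℕₚ.<-cmp m n
    ... | tri< m<n _ _ = contradiction (sym eq) (<⇒ι≉ι m<n)
    ... | tri≈ _ m≡n _ = m≡n
    ... | tri> _ _ n<m = contradiction eq (<⇒ι≉ι n<m)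

    EventuallyNonzero : Poly → Set ℓ₁
    EventuallyNonzero p = ∃[ N ] (∀ n → N ℕ.≤ n → ¬ eval p (ι n) ≈ 0#)

    -- A natural root can be divided out, which shortens the coefficient list.
    eventually-nonzero : ∀ p → ¬ IsZero p → EventuallyNonzero p
    eventually-nonzero p = go (length p) p ≡.refl
      where
      go : ∀ l p → length p ≡ l → ¬ IsZero p → EventuallyNonzero p
      go l       []      _   p≉0 = contradiction (λ _ → refl) p≉0
      go (suc l) (a ∷ p) len p≉0 with emˡ {∃[ x ] eval (a ∷ p) (ι x) ≈ 0#}
      ... | no  rootless   = 0 , λ n _ root → rootless (n , root)
      ... | yes (x , root)
        with go l (quotient (ι x) p) (≡.trans (length-quotient (ι x) p) (ℕₚ.suc-injective len)) q≉0
        where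
        q≉0 : ¬ IsZero (quotient (ι x) p)
        q≉0 q≈0 = p≉0 (IsZero-∷ (constant-term≈0 p root p≈0) p≈0)
          where p≈0 = quotient≈0⇒tail≈0 (ι x) p q≈0
      ...   | N , q-nonzero = N ℕ.⊔ suc x , λ n N≤n pn≈0 →
              *-≉0 (λ eq → <⇒ι≉ι (ℕₚ.m⊔n≤o⇒n≤o N (suc x) N≤n) (x-y≈0⇒x≈y eq))
                   (q-nonzero n (ℕₚ.m⊔n≤o⇒m≤o N (suc x) N≤n))
                   (begin
                     (ι n - ι x) * eval (quotient (ι x) p) (ι n)       ≈⟨ +-identityʳ _ ⟨
                     (ι n - ι x) * eval (quotient (ι x) p) (ι n) + 0#  ≈⟨ +-congˡ root ⟨
                     _                                                ≈⟨ quotient-correct (ι x) a p (ι n) ⟨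
                     eval (a ∷ p) (ι n)                               ≈⟨ pn≈0 ⟩
                     0#                                               ∎)

    eventually-nonzero⇒≉0 : ∀ p → EventuallyNonzero p → ¬ IsZero p
    eventually-nonzero⇒≉0 p (N , nz) p≈0 = nz N ℕₚ.≤-refl (IsZero⇒eval≈0 p p≈0 (ι N))

    vanishing⇒IsZero : ∀ p → (∀ n → eval p (ι n) ≈ 0#) → IsZero p
    vanishing⇒IsZero p vanishes with emˡ {IsZero p}
    ... | yes p≈0 = p≈0
    ... | no  p≉0 with eventually-nonzero p p≉0
    ...   | N , nz = contradiction (vanishes N) (nz N ℕₚ.≤-refl)

    -- Rewriting is done on values but degrees are read off coefficients; this is the bridge between
    -- them.
    coeff-unique : ∀ p q → (∀ x → eval p x ≈ eval q x) → ∀ i → coeff p i ≈ coeff q i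
    coeff-unique p q eq i = x-y≈0⇒x≈y (trans (sym (coeff-- p q i))
      (vanishing⇒IsZero (p -ₚ q) (λ n → begin
        eval (p -ₚ q) (ι n)              ≈⟨ eval-- p q (ι n) ⟩
        eval p (ι n) - eval q (ι n)      ≈⟨ +-congʳ (eq (ι n)) ⟩
        eval q (ι n) - eval q (ι n)      ≈⟨ -‿inverseʳ _ ⟩
        0#                               ∎) i))

    -- Beyond both thresholds the values of the factors are nonzero, so no comparison of leading
    -- coefficients is needed.
    *ₚ-≉0 : ∀ p q → ¬ IsZero p → ¬ IsZero q → ¬ IsZero (p *ₚ q)
    *ₚ-≉0 p q p≉0 q≉0 with eventually-nonzero p p≉0 | eventually-nonzero q q≉0
    ... | M , p-nz | N , q-nz = eventually-nonzero⇒≉0 (p *ₚ q) (M ℕ.⊔ N , λ n le pq≈0 →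
      *-≉0 (p-nz n (ℕₚ.m⊔n≤o⇒m≤o M N le)) (q-nz n (ℕₚ.m⊔n≤o⇒n≤o M N le))
           (trans (sym (eval-* p q (ι n))) pq≈0))

    1ₚ≉0 : ¬ IsZero (1# ∷ [])
    1ₚ≉0 1≈0 = 1≉0 (1≈0 0)

    prodₚ-≉0 : ∀ {m} (v : Vector Poly m) → (∀ i → ¬ IsZero (v i)) → ¬ IsZero (prodₚ v)
    prodₚ-≉0 {zero}  v v≉0 = 1ₚ≉0
    prodₚ-≉0 {suc m} v v≉0 = *ₚ-≉0 (v zero) _ (v≉0 zero) (prodₚ-≉0 (v ∘ suc) (v≉0 ∘ suc))

    eval-prod≉0 : ∀ {m} (v : Vector Poly m) x → (∀ i → ¬ eval (v i) x ≈ 0#) →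
                  ¬ eval (prodₚ v) x ≈ 0#
    eval-prod≉0 {zero}  v x v≉0 eq = 1≉0 (trans (sym (eval-const 1# x)) eq)
    eval-prod≉0 {suc m} v x v≉0 eq =
      *-≉0 (v≉0 zero) (eval-prod≉0 (v ∘ suc) x (v≉0 ∘ suc)) (trans (sym (eval-* (v zero) _ x)) eq)

    -- Evaluating the translate at `ι n - e` recovers the value of `p` at `ι n`.
    translate-≉0 : ∀ e p → ¬ IsZero p → ¬ IsZero (translate e p)
    translate-≉0 e p p≉0 Tp≈0 = p≉0 (vanishing⇒IsZero p λ n → begin
      eval p (ι n)                      ≈⟨ eval-cong p (x-y+y (ι n) e) ⟨
      eval p ((ι n - e) + e)            ≈⟨ eval-translate e p (ι n - e) ⟨
      eval (translate e p) (ι n - e)    ≈⟨ IsZero⇒eval≈0 (translate e p) Tp≈0 (ι n - e) ⟩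
      0#                                ∎)

    -- Degrees and degree bounds.

    zero-or-degree : ∀ p → IsZero p ⊎ ∃[ d ] HasDegree p d
    zero-or-degree [] = inj₁ λ _ → refl
    zero-or-degree (a ∷ p) with zero-or-degree p
    ... | inj₂ (d , lead , above) = inj₂ (suc d , lead , λ { (suc i) (s≤s d<i) → above i d<i })
    ... | inj₁ p≈0 with emˡ {a ≈ 0#}
    ...   | yes a≈0 = inj₁ (IsZero-∷ a≈0 p≈0)
    ...   | no  a≉0 = inj₂ (0 , a≉0 , λ { (suc i) _ → p≈0 i })

    -- DegreeBound p m k says deg p ≤ m - k; keeping the two naturals apart avoids
    -- truncated subtraction, and m < k makes p zero.
    DegreeBound : Poly → ℕ → ℕ → Set ℓ₁
    DegreeBound p m k = ∀ i → m ℕ.< i ℕ.+ k → coeff p i ≈ 0#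

    bound-+ : ∀ p q {m k} → DegreeBound p m k → DegreeBound q m k → DegreeBound (p +ₚ q) m k
    bound-+ p q bp bq i m<i+k = trans (coeff-+ p q i) (0+0 (bp i m<i+k) (bq i m<i+k))

    bound-· : ∀ a p {m k} → DegreeBound p m k → DegreeBound (a ·ₚ p) m k
    bound-· a p bp i m<i+k = trans (coeff-· a p i) (*0 (bp i m<i+k))

    bound-tail : ∀ {a p m k} → DegreeBound (a ∷ p) m k → DegreeBound p m (suc k)
    bound-tail {m = m} {k} b i m<i+1+k = b (suc i) (≡.subst (m ℕ.<_) (ℕₚ.+-suc i k) m<i+1+k)

    bound-shift : ∀ p {m k} → DegreeBound p m (suc k) → DegreeBound (0# ∷ p) m k
    bound-shift p b zero    _         = refl
    bound-shift p {m} {k} b (suc i) m<1+i+k = b i (≡.subst (m ℕ.<_) (≡.sym (ℕₚ.+-suc i k)) m<1+i+k)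

    bound-* : ∀ p q {m k m′ k′} → DegreeBound p m k → DegreeBound q m′ k′ →
              DegreeBound (p *ₚ q) (m ℕ.+ m′) (k ℕ.+ k′)
    bound-* []      q bp bq i lt = refl
    bound-* (a ∷ p) q {m} {k} {m′} {k′} bp bq =
      bound-+ (a ·ₚ q) (0# ∷ p *ₚ q) head
        (bound-shift (p *ₚ q) (bound-* p q (bound-tail bp) bq))
      where
      head : DegreeBound (a ·ₚ q) (m ℕ.+ m′) (k ℕ.+ k′)
      head i lt with sum-< m m′ k i k′ lt
      ... | inj₁ m<k      = trans (coeff-· a q i) (0* (bp 0 m<k))
      ... | inj₂ m′<i+k′ = bound-· a q bq i m′<i+k′

    bound-const : ∀ {a m k} p → DegreeBound (a ∷ p) m k → DegreeBound (a ∷ []) m k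
    bound-const p b zero    lt = b zero lt
    bound-const p b (suc i) lt = refl

    bound-translate : ∀ e p {m k} → DegreeBound p m k → DegreeBound (translate e p) m k
    bound-translate e []      b = b
    bound-translate e (a ∷ p) {m} {k} b =
      bound-+ (a ∷ []) ((e ∷ 1# ∷ []) *ₚ translate e p) (bound-const p b)
        -- The tail has bound `m - (k + 1)` and the linear factor contributes 1, so the product is
        -- bounded by `suc m` against `suc k`, and the successors cancel.
        λ i m<i+k → bound-* (e ∷ 1# ∷ []) (translate e p) {1} {0} linear
          (bound-translate e p (bound-tail b)) i
          (≡.subst (suc m ℕ.<_) (≡.sym (ℕₚ.+-suc i k)) (s≤s m<i+k))
      where
      linear : DegreeBound (e ∷ 1# ∷ []) 1 0
      linear zero          ()
      linear (suc zero)    (s≤s ())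
      linear (suc (suc i)) _ = refl

    bound-sum : ∀ {n} (v : Vector Poly n) {m k} → (∀ i → DegreeBound (v i) m k) →
                DegreeBound (sumₚ v) m k
    bound-sum {zero}  v b = λ _ _ → refl
    bound-sum {suc n} v b = bound-+ (v zero) _ (b zero) (bound-sum (v ∘ suc) (b ∘ suc))

    bound-mono : ∀ s → DegreeBound (mono s) s 0
    bound-mono zero    (suc i) _           = refl
    bound-mono (suc s) zero    _           = refl
    bound-mono (suc s) (suc i) (s≤s s<i+0) = bound-mono s i s<i+0

    -- Forward differences

    Δₚ : Poly → Poly
    Δₚ p = translate 1# p -ₚ p

    eval-Δ : ∀ p x → eval (Δₚ p) x ≈ eval p (x + 1#) - eval p x
    eval-Δ p x = trans (eval-- (translate 1# p) p x) (+-congʳ (eval-translate 1# p x))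

    -- Trades a subtraction for an addition, so that the rest can go to the semiring solver.
    x≈z+y⇒x-y≈z : ∀ {x y z} → x ≈ z + y → x - y ≈ z
    x≈z+y⇒x-y≈z {x} {y} {z} eq = ∙-cancelʳ y _ _ (trans (x-y+y x y) eq)

    -- The product rule for the difference of `n p(n)`; the constant `a` cancels.
    eval-Δ-∷ : ∀ a p x → eval (Δₚ (a ∷ p)) x ≈ eval (translate 1# p +ₚ (0# ∷ Δₚ p)) x
    eval-Δ-∷ a p x = begin
      eval (Δₚ (a ∷ p)) x
        ≈⟨ eval-Δ (a ∷ p) x ⟩
      (a + (x + 1#) * u) - (a + x * v)
        ≈⟨ x≈z+y⇒x-y≈z (begin
             a + (x + 1#) * u                          ≈⟨ +-congˡ (*-congˡ (x-y+y u v)) ⟨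
             a + (x + 1#) * (d + v)                    ≈⟨ rearrange a x d v ⟩
             ((d + v) + x * d) + (a + x * v)           ≈⟨ +-congʳ (+-congʳ (x-y+y u v)) ⟩
             (u + x * d) + (a + x * v)                 ∎) ⟩
      u + x * (u - v)
        ≈⟨ +-cong (eval-translate 1# p x) (*-congˡ (eval-Δ p x)) ⟨
      eval (translate 1# p) x + x * eval (Δₚ p) x
        ≈⟨ +-congˡ (+-identityˡ _) ⟨
      eval (translate 1# p) x + eval (0# ∷ Δₚ p) x
        ≈⟨ eval-+ (translate 1# p) (0# ∷ Δₚ p) x ⟨
      eval (translate 1# p +ₚ (0# ∷ Δₚ p)) x ∎
      where
      u = eval p (x + 1#)
      v = eval p x
      d = u - v
      rearrange : ∀ a x d v → a + (x + 1#) * (d + v) ≈ ((d + v) + x * d) + (a + x * v)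
      rearrange = solve 4 (λ a x d v →
        (a :+ (x :+ con 1) :* (d :+ v)) := (((d :+ v) :+ x :* d) :+ (a :+ x :* v))) refl

    -- In the product rule `p(n+1)` already has degree one less than `a + n p(n)`, and by induction
    -- so has `n` times the difference of `p`.
    bound-Δ : ∀ p {m k} → DegreeBound p m k → DegreeBound (Δₚ p) m (suc k)
    bound-Δ []      b = λ _ _ → refl
    bound-Δ (a ∷ p) b i lt =
      trans (coeff-unique (Δₚ (a ∷ p)) (translate 1# p +ₚ (0# ∷ Δₚ p)) (eval-Δ-∷ a p) i)
            (bound-+ (translate 1# p) (0# ∷ Δₚ p)
              (bound-translate 1# p (bound-tail b))
              (bound-shift (Δₚ p) (bound-Δ p (bound-tail b))) i lt)

    -- The innermost difference is peeled off, so that the induction in `newton` can pass from `p`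
    -- to `Δₚ p`.
    Δₚ^ : ℕ → Poly → Poly
    Δₚ^ zero    p = p
    Δₚ^ (suc k) p = Δₚ^ k (Δₚ p)

    bound-Δ^ : ∀ j p {m k} → DegreeBound p m k → DegreeBound (Δₚ^ j p) m (j ℕ.+ k)
    bound-Δ^ zero    p b = b
    bound-Δ^ (suc j) p {m} {k} b =
      ≡.subst (DegreeBound (Δₚ^ j (Δₚ p)) m) (ℕₚ.+-suc j k) (bound-Δ^ j (Δₚ p) (bound-Δ p b))

    -- Newton's forward difference formula, by Pascal's rule. The upper limit is any `J` with
    -- `j ≤ J`, the extra binomials being 0: with one limit for all `j`, the double sum in
    -- `adjoint-expansion` is over a square and can be interchanged.
    newton : ∀ {j J} → j ℕ.≤ J → ∀ p x →
      sum {suc J} (λ k → ι (j C toℕ k) * eval (Δₚ^ (toℕ k) p) x) ≈ eval p (x + ι j)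
    newton {zero} {J} z≤n p x = begin
      ι 1 * eval p x + _   ≈⟨ +-cong (*-congʳ (+-identityʳ 1#)) (sum-zero {J} λ _ → 0* refl) ⟩
      1# * eval p x + 0#   ≈⟨ +-identityʳ _ ⟩
      1# * eval p x        ≈⟨ *-identityˡ _ ⟩
      eval p x             ≈⟨ eval-cong p (+-identityʳ x) ⟨
      eval p (x + 0#)      ∎
    newton {suc j} {suc J} (s≤s j≤J) p x = begin
      ι (suc j C 0) * eval p x + sum {suc J} (λ k → ι (suc j C suc (toℕ k)) * D k)
        ≈⟨ +-cong (*-congʳ (ι-cong (≡.trans (nC0≡1 (suc j)) (≡.sym (nC0≡1 j))))) (sum-cong-≋ pascal) ⟩
      ι (j C 0) * eval p x + sum {suc J} (λ k → ι (j C suc (toℕ k)) * D k + ι (j C toℕ k) * D k)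
        ≈⟨ +-congˡ (∑-distrib-+ {suc J} (λ k → ι (j C suc (toℕ k)) * D k) (λ k → ι (j C toℕ k) * D k)) ⟩
      ι (j C 0) * eval p x + (sum {suc J} (λ k → ι (j C suc (toℕ k)) * D k) + sum {suc J} (λ k → ι (j C toℕ k) * D k))
        ≈⟨ +-assoc _ _ _ ⟨
      (ι (j C 0) * eval p x + sum {suc J} (λ k → ι (j C suc (toℕ k)) * D k)) + sum {suc J} (λ k → ι (j C toℕ k) * D k)
        -- The bracket is the formula for `p` with limit `suc J`, the other sum the formula for
        -- `Δₚ p` with limit `J`.
        ≈⟨ +-cong (newton (ℕₚ.m≤n⇒m≤1+n j≤J) p x) (newton j≤J (Δₚ p) x) ⟩
      eval p (x + ι j) + eval (Δₚ p) (x + ι j)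
        ≈⟨ +-congˡ (eval-Δ p (x + ι j)) ⟩
      eval p (x + ι j) + (eval p (x + ι j + 1#) - eval p (x + ι j))
        ≈⟨ trans (+-comm _ _) (x-y+y _ _) ⟩
      eval p (x + ι j + 1#)
        ≈⟨ eval-cong p (trans (+-assoc x (ι j) 1#) (+-congˡ (+-comm (ι j) 1#))) ⟩
      eval p (x + ι (suc j)) ∎
      where
      D : Fin (suc J) → Carrier
      D k = eval (Δₚ^ (toℕ k) (Δₚ p)) x
      pascal : ∀ k → ι (suc j C suc (toℕ k)) * D k ≈ ι (j C suc (toℕ k)) * D k + ι (j C toℕ k) * D k
      pascal k = begin
        ι (suc j C suc (toℕ k)) * D k
          ≈⟨ *-congʳ (ι-cong (nCk+nC[k+1]≡[n+1]C[k+1] j (toℕ k))) ⟨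
        ι (j C toℕ k ℕ.+ j C suc (toℕ k)) * D k
          ≈⟨ *-congʳ (trans (ι-+ (j C toℕ k) _) (+-comm _ _)) ⟩
        (ι (j C suc (toℕ k)) + ι (j C toℕ k)) * D k
          ≈⟨ distribʳ _ _ _ ⟩
        ι (j C suc (toℕ k)) * D k + ι (j C toℕ k) * D k ∎

    -- The adjoint operator

    -- Written `0# - ι i` rather than `- ι i` to agree definitionally with the shift in `adjoint`.
    back : ℕ → Carrier
    back i = 0# - ι i

    eval-adjoint : ∀ {J} (a : Op J) x t → eval (adjoint a x) t ≈
      sum λ i → eval (a i) (t + back (toℕ i)) * eval x (t + back (toℕ i))
    eval-adjoint a x t = trans
      (eval-sum (λ i → translate (back (toℕ i)) (a i) *ₚ translate (back (toℕ i)) x) t)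
      (sum-cong-≋ λ i →
        trans (eval-* (translate (back (toℕ i)) (a i)) (translate (back (toℕ i)) x) t)
              (*-cong (eval-translate (back (toℕ i)) (a i) t) (eval-translate (back (toℕ i)) x t)))

    ι-opposite : ∀ {J} (j : Fin (suc J)) → ι J ≈ ι (toℕ (opposite j)) + ι (toℕ j)
    ι-opposite {J} j = trans (ι-cong (≡.sym (≡.trans
      (≡.cong (ℕ._+ toℕ j) (Finₚ.opposite-prop j)) (ℕₚ.m∸n+n≡m (Finₚ.toℕ≤pred[n] j)))))
      (ι-+ (toℕ (opposite j)) (toℕ j))

    back-opposite : ∀ {J} (j : Fin (suc J)) → back (toℕ (opposite j)) ≈ ι (toℕ j) - ι J
    back-opposite {J} j = sym (x≈z+y⇒x-y≈z (begin
      ι (toℕ j)                                                ≈⟨ +-identityˡ _ ⟨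
      0# + ι (toℕ j)                                           ≈⟨ +-congʳ (x-y+y 0# o) ⟨
      (back (toℕ (opposite j)) + o) + ι (toℕ j)                ≈⟨ +-assoc _ _ _ ⟩
      back (toℕ (opposite j)) + (o + ι (toℕ j))                ≈⟨ +-congˡ (ι-opposite j) ⟨
      back (toℕ (opposite j)) + ι J                            ∎))
      where o = ι (toℕ (opposite j))

    -- L*(x) = ∑ₖ bₖ Δᵏ y with y(n) = x(n - J), because σʲ = (1 + Δ)ʲ.
    adjoint-expansion : ∀ {J} (a : Op J) x t → eval (adjoint a x) t ≈
      eval (sumₚ λ (k : Fin (suc J)) → bPoly a (toℕ k) *ₚ Δₚ^ (toℕ k) (translate (back J) x)) t
    adjoint-expansion {J} a x t = begin
      eval (adjoint a x) t
        ≈⟨ eval-adjoint a x t ⟩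
      sum E
        -- With `i = J - j`, the shift back by `i` becomes a shift forward by `j` of `x(n - J)`, to
        -- which Newton's formula applies.
        ≈⟨ sum-permute E Perm.reverse ⟩
      sum (λ j → E (opposite j))
        ≈⟨ sum-cong-≋ shift-points ⟩
      sum (λ j → A j * sum (λ k → B j k * D k))
        ≈⟨ sum-cong-≋ distribute ⟩
      sum (λ j → sum (λ k → (B j k * A j) * D k))
        ≈⟨ ∑-comm (λ j k → (B j k * A j) * D k) ⟩
      sum (λ k → sum (λ j → (B j k * A j) * D k))
        ≈⟨ sum-cong-≋ collect ⟨
      sum (λ k → eval (v k) t)
        ≈⟨ eval-sum v t ⟨
      eval (sumₚ v) t ∎
      where
      y = translate (back J) x
      v : Vector Poly (suc J)
      v k = bPoly a (toℕ k) *ₚ Δₚ^ (toℕ k) y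
      A D E : Fin (suc J) → Carrier
      E i = eval (a i) (t + back (toℕ i)) * eval x (t + back (toℕ i))
      A j = eval (a (opposite j)) (t + (ι (toℕ j) - ι J))
      D k = eval (Δₚ^ (toℕ k) y) t
      B : Fin (suc J) → Fin (suc J) → Carrier
      B j k = ι (toℕ j C toℕ k)
      rearrange : ∀ a b d → a * (b * d) ≈ (b * a) * d
      rearrange = solve 3 (λ a b d → (a :* (b :* d)) := ((b :* a) :* d)) refl
      point : ∀ j → eval x (t + back (toℕ (opposite j))) ≈ eval y (t + ι (toℕ j))
      point j = begin
        eval x (t + back (toℕ (opposite j)))    ≈⟨ eval-cong x (+-congˡ (back-opposite j)) ⟩
        eval x (t + (ι (toℕ j) - ι J))          ≈⟨ eval-cong x (+-congˡ (+-congˡ (+-identityˡ _))) ⟨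
        eval x (t + (ι (toℕ j) + back J))       ≈⟨ eval-cong x (+-assoc t (ι (toℕ j)) (back J)) ⟨
        eval x (t + ι (toℕ j) + back J)         ≈⟨ eval-translate (back J) x (t + ι (toℕ j)) ⟨
        eval y (t + ι (toℕ j))                  ∎
      eval-b : ∀ k → eval (bPoly a (toℕ k)) t ≈ sum (λ j → B j k * A j)
      eval-b k = trans
        (eval-sum (λ j → B j k ·ₚ translate (ι (toℕ j) - ι J) (a (opposite j))) t)
        (sum-cong-≋ λ j →
          trans (eval-· (B j k) (translate (ι (toℕ j) - ι J) (a (opposite j))) t)
                (*-congˡ (eval-translate (ι (toℕ j) - ι J) (a (opposite j)) t)))
      shift-points : ∀ j → E (opposite j) ≈ A j * sum (λ k → B j k * D k)
      shift-points j = *-cong (eval-cong (a (opposite j)) (+-congˡ (back-opposite j)))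
        (trans (point j) (sym (newton (Finₚ.toℕ≤pred[n] j) y t)))
      distribute : ∀ j → A j * sum (λ k → B j k * D k) ≈ sum (λ k → (B j k * A j) * D k)
      distribute j = trans (*-distribˡ-sum (A j) (λ k → B j k * D k))
        (sum-cong-≋ λ k → rearrange (A j) (B j k) (D k))
      collect : ∀ k → eval (v k) t ≈ sum (λ j → (B j k * A j) * D k)
      collect k = trans (eval-* (bPoly a (toℕ k)) (Δₚ^ (toℕ k) y) t)
        (trans (*-congʳ (eval-b k)) (*-distribʳ-sum (D k) (λ j → B j k * A j)))

    -- With `d - e` bounding deg L, the factor b_k has degree at most `d - e + k` and the k-th
    -- difference at most `s - k`, so `k` cancels in every summand of the expansion.
    bound-adjoint : ∀ {J} (a : Op J) {d e} →
      (∀ k → k ℕ.≤ J → DegreeBound (bPoly a k) (d ℕ.+ k) e) →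
      ∀ x {s} → DegreeBound x s 0 → DegreeBound (adjoint a x) (d ℕ.+ s) e
    bound-adjoint {J} a {d} {e} b-bound x {s} x-bound i lt =
      trans (coeff-unique (adjoint a x) (sumₚ v) (adjoint-expansion a x) i)
            (bound-sum v v-bound i lt)
      where
      y = translate (back J) x
      v : Vector Poly (suc J)
      v k = bPoly a (toℕ k) *ₚ Δₚ^ (toℕ k) y
      v-bound : ∀ k → DegreeBound (v k) (d ℕ.+ s) e
      v-bound k i lt = bound-* (bPoly a (toℕ k)) (Δₚ^ (toℕ k) y)
        (b-bound (toℕ k) (Finₚ.toℕ≤pred[n] k))
        (bound-Δ^ (toℕ k) y (bound-translate (back J) x x-bound)) i
        (≡.subst₂ ℕ._<_ (≡.sym (xy∙z≈xz∙y d (toℕ k) s))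
          (≡.trans (ℕₚ.+-assoc i e (toℕ k)) (≡.cong (λ j → i ℕ.+ (e ℕ.+ j)) (≡.sym (ℕₚ.+-identityʳ (toℕ k)))))
          (ℕₚ.+-monoˡ-< (toℕ k) lt))
        where open import Algebra.Properties.CommutativeSemigroup ℕₚ.+-commutativeSemigroup using (xy∙z≈xz∙y)

    -- Nonvanishing of the adjoint and existence of the continued zero index.

    module _ {J} (a : Op J) where

      -- The adjoint on arbitrary functions, so that the product of a monomial and `x` need not be
      -- formed as a polynomial.
      weighted : (Carrier → Carrier) → Carrier → Carrier
      weighted g t = sum λ i → eval (a i) (t + back (toℕ i)) * g (t + back (toℕ i))

      -- Linearity of the adjoint. The extra factor `mono s` carries the induction on the
      -- coefficient list: each coefficient consumed raises `s` by one.
      weighted-vanishes : (∀ s → IsZero (adjoint a (mono s))) →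
        ∀ x s t → weighted (λ z → eval (mono s) z * eval x z) t ≈ 0#
      weighted-vanishes adj≈0 []      s t = sum-zero vanish
        where
        vanish : ∀ i → eval (a i) (t + back (toℕ i)) * (eval (mono s) (t + back (toℕ i)) * 0#) ≈ 0#
        vanish i = *0 (zeroʳ _)
      weighted-vanishes adj≈0 (b ∷ x) s t = begin
        sum (λ i → A i * (eval (mono s) (z i) * (b + z i * eval x (z i))))
          ≈⟨ sum-cong-≋ (λ i → trans (rearrange (A i) (eval (mono s) (z i)) b (z i) (eval x (z i)))
               (+-congˡ (*-congˡ (*-congʳ (sym (+-identityˡ _)))))) ⟩
        sum (λ i → b * (A i * eval (mono s) (z i)) + A i * (eval (mono (suc s)) (z i) * eval x (z i)))
          ≈⟨ ∑-distrib-+ (λ i → b * (A i * eval (mono s) (z i)))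
                         (λ i → A i * (eval (mono (suc s)) (z i) * eval x (z i))) ⟩
        sum (λ i → b * (A i * eval (mono s) (z i))) + weighted (λ z → eval (mono (suc s)) z * eval x z) t
          ≈⟨ 0+0 (trans (sym (*-distribˡ-sum b (λ i → A i * eval (mono s) (z i))))
                        (*0 (trans (sym (eval-adjoint a (mono s) t)) (IsZero⇒eval≈0 (adjoint a (mono s)) (adj≈0 s) t))))
                 (weighted-vanishes adj≈0 x (suc s) t) ⟩
        0# ∎
        where
        z A : Fin (suc J) → Carrier
        z i = t + back (toℕ i)
        A i = eval (a i) (z i)
        rearrange : ∀ A m b z e → A * (m * (b + z * e)) ≈ b * (A * m) + A * ((z * m) * e)
        rearrange = solve 5 (λ A m b z e →
          (A :* (m :* (b :+ z :* e))) := (b :* (A :* m) :+ A :* ((z :* m) :* e))) refl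

      adjoint-vanishes : (∀ s → IsZero (adjoint a (mono s))) → ∀ x t → eval (adjoint a x) t ≈ 0#
      adjoint-vanishes adj≈0 x t = begin
        eval (adjoint a x) t
          ≈⟨ eval-adjoint a x t ⟩
        weighted (eval x) t
          ≈⟨ sum-cong-≋ unit ⟨
        weighted (λ z → eval (mono 0) z * eval x z) t
          ≈⟨ weighted-vanishes adj≈0 x 0 t ⟩
        0# ∎
        where
        z : Fin (suc J) → Carrier
        z i = t + back (toℕ i)
        unit : ∀ i → eval (a i) (z i) * (eval (mono 0) (z i) * eval x (z i)) ≈ eval (a i) (z i) * eval x (z i)
        unit i = *-congˡ (trans (*-congʳ (eval-const 1# (z i))) (*-identityˡ _))

      -- Test against the polynomial whose roots are the points m - k with k ≠ i: only
      -- the value of aᵢ at m - i survives.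
      adjoint≈0⇒op≈0 : (∀ x t → eval (adjoint a x) t ≈ 0#) → IsZeroOp a
      adjoint≈0⇒op≈0 adj≈0 i = vanishing⇒IsZero (a i) λ n → value n
        where
        module _ (n : ℕ) where
          -- With this choice `z i` is `ι n`, so varying `n` reaches all natural arguments of `a i`.
          t = ι (n ℕ.+ toℕ i)
          z : Fin (suc J) → Carrier
          z k = t + back (toℕ k)
          factor : Vector Poly (suc J)
          factor k = (- z k) ∷ 1# ∷ []
          x = prodₚ (removeAt factor i)
          term : Fin (suc J) → Carrier
          term k = eval (a k) (z k) * eval x (z k)

          -- Characteristic 0 keeps the points distinct, so `x` does not vanish at `z i`.
          z-injective : ∀ {k l} → z k ≈ z l → k ≡ l
          z-injective eq = Finₚ.toℕ-injective (ι-injective (⁻¹-injective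
            (∙-cancelˡ 0# _ _ (∙-cancelˡ t _ _ eq))))

          others≈0 : ∀ k → term (punchIn i k) ≈ 0#
          others≈0 k = *0 (eval-prod≈0 (removeAt factor i) k
            (trans (eval-linear (- z (punchIn i k)) (z (punchIn i k))) (-‿inverseʳ _)))

          x≉0 : ¬ eval x (z i) ≈ 0#
          x≉0 = eval-prod≉0 (removeAt factor i) (z i) λ k root → Finₚ.punchInᵢ≢i i k
            (≡.sym (z-injective (x-y≈0⇒x≈y (trans (sym (eval-linear (- z (punchIn i k)) (z i))) root))))

          value : eval (a i) (ι n) ≈ 0#
          value = trans (eval-cong (a i) (sym zi≈n)) (*-cancel-≉0 x≉0 (begin
            eval x (z i) * eval (a i) (z i)        ≈⟨ *-comm _ _ ⟩
            term i                                 ≈⟨ +-identityʳ _ ⟨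
            term i + 0#                            ≈⟨ +-congˡ (sum-zero others≈0) ⟨
            term i + sum (removeAt term i)         ≈⟨ sum-remove {i = i} term ⟨
            sum term                               ≈⟨ eval-adjoint a x t ⟨
            eval (adjoint a x) t                   ≈⟨ adj≈0 x t ⟩
            0#                                     ∎))
            where
            zi≈n : z i ≈ ι n
            zi≈n = begin
              t + (0# - ι (toℕ i))                   ≈⟨ +-congˡ (+-identityˡ _) ⟩
              t - ι (toℕ i)                          ≈⟨ x≈z+y⇒x-y≈z (ι-+ n (toℕ i)) ⟩
              ι n                                    ∎

      -- If every monomial were killed, the adjoint would vanish on all polynomials and `a` would be
      -- zero. The index is the least surviving exponent.
      continued-zero-index : ¬ IsZeroOp a → ∃[ s ] HasContinuedZeroIndex a s
      continued-zero-index a≉0 = s , nonzero , λ i i<s → decidable-stable emˡ (minimal i i<s)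
        where
        Vanishes NonVanishing : ℕ → Set ℓ₁
        Vanishes s = IsZero (adjoint a (mono s))
        NonVanishing s = ¬ Vanishes s
        witness : ∃[ s ] NonVanishing s
        witness = ¬∀⇒∃¬ emˡ {P = Vanishes} λ adj≈0 → a≉0 (adjoint≈0⇒op≈0 (adjoint-vanishes adj≈0))
        first : ∃[ s ] NonVanishing s × (∀ m → m ℕ.< s → ¬ NonVanishing m)
        first = least emˡ {P = NonVanishing} witness
        s = proj₁ first
        nonzero = proj₁ (proj₂ first)
        minimal = proj₂ (proj₂ first)

    -- Degree of an operator

    degree-unique : ∀ {p d d′} → HasDegree p d → HasDegree p d′ → d′ ℕ.≤ d
    degree-unique {d = d} {d′} (_ , above) (lead , _) = ℕₚ.≮⇒≥ λ d<d′ → lead (above d′ d<d′)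

    -- Zero polynomials count as degree minus infinity, so a range of zeros has no maximum in the
    -- integers and forms the first alternative.
    maximal-degree : (b : ℕ → Poly) → ∀ n → (∀ k → k ℕ.< n → IsZero (b k)) ⊎
      Σ[ D ∈ ℤ ] (Σ[ k ∈ ℕ ] Σ[ d ∈ ℕ ] k ℕ.< n × HasDegree (b k) d × D ≡ + d ℤ.- + k) ×
                 (∀ k d → k ℕ.< n → HasDegree (b k) d → + d ℤ.- + k ℤ.≤ D)
    maximal-degree b zero = inj₁ λ _ ()
    maximal-degree b (suc n) with maximal-degree b n | zero-or-degree (b n)
    ... | inj₁ zeros | inj₁ bn≈0 = inj₁ (<-suc-elim (IsZero ∘ b) zeros bn≈0)
    ... | inj₁ zeros | inj₂ (e , deg-e) =
      inj₂ (+ e ℤ.- + n , (n , e , ℕₚ.≤-refl , deg-e , ≡.refl) , λ k d k<1+n →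
        <-suc-elim (λ k → HasDegree (b k) d → + d ℤ.- + k ℤ.≤ + e ℤ.- + n)
          (λ k k<n (lead , _) → contradiction (zeros k k<n d) lead)
          (λ deg-d → ℤₚ.+-monoˡ-≤ (ℤ.- + n) (ℤ.+≤+ (degree-unique {b n} deg-e deg-d))) k k<1+n)
    ... | inj₂ (D , (k₀ , d₀ , k₀<n , deg-d₀ , D≡) , max) | inj₁ bn≈0 =
      inj₂ (D , (k₀ , d₀ , ℕₚ.m<n⇒m<1+n k₀<n , deg-d₀ , D≡) , λ k d k<1+n →
        <-suc-elim (λ k → HasDegree (b k) d → + d ℤ.- + k ℤ.≤ D)
          (λ k → max k d) (λ (lead , _) → contradiction (bn≈0 d) lead) k k<1+n)
    ... | inj₂ (D , (k₀ , d₀ , k₀<n , deg-d₀ , D≡) , max) | inj₂ (e , deg-e)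
      with ℤₚ.≤-total D (+ e ℤ.- + n)
    ...   | inj₁ D≤ =
      inj₂ (+ e ℤ.- + n , (n , e , ℕₚ.≤-refl , deg-e , ≡.refl) , λ k d k<1+n →
        <-suc-elim (λ k → HasDegree (b k) d → + d ℤ.- + k ℤ.≤ + e ℤ.- + n)
          (λ k k<n deg-d → ℤₚ.≤-trans (max k d k<n deg-d) D≤)
          (λ deg-d → ℤₚ.+-monoˡ-≤ (ℤ.- + n) (ℤ.+≤+ (degree-unique {b n} deg-e deg-d))) k k<1+n)
    ...   | inj₂ ≤D =
      inj₂ (D , (k₀ , d₀ , ℕₚ.m<n⇒m<1+n k₀<n , deg-d₀ , D≡) , λ k d k<1+n →
        <-suc-elim (λ k → HasDegree (b k) d → + d ℤ.- + k ℤ.≤ D)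
          (λ k → max k d)
          (λ deg-d → ℤₚ.≤-trans
            (ℤₚ.+-monoˡ-≤ (ℤ.- + n) (ℤ.+≤+ (degree-unique {b n} deg-e deg-d))) ≤D) k k<1+n)

    -- Were all b_k zero, the expansion would make the adjoint vanish, and with it `a`.
    op-degree : ∀ {J} (a : Op J) → ¬ IsZeroOp a → ∃[ D ] HasOpDegree a D
    op-degree {J} a a≉0 with maximal-degree (bPoly a) (suc J)
    ... | inj₂ (D , (k , d , s≤s k≤J , deg-d , D≡) , max) =
      D , (k , d , k≤J , deg-d , D≡) , λ k d k≤J → max k d (s≤s k≤J)
    ... | inj₁ zeros = contradiction (adjoint≈0⇒op≈0 a adj≈0) a≉0
      where
      adj≈0 : ∀ x t → eval (adjoint a x) t ≈ 0#
      adj≈0 x t = begin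
        eval (adjoint a x) t      ≈⟨ adjoint-expansion a x t ⟩
        eval (sumₚ v) t           ≈⟨ eval-sum v t ⟩
        sum (λ k → eval (v k) t)  ≈⟨ sum-zero v≈0 ⟩
        0#                        ∎
        where
        v : Vector Poly (suc J)
        v k = bPoly a (toℕ k) *ₚ Δₚ^ (toℕ k) (translate (back J) x)
        v≈0 : ∀ k → eval (v k) t ≈ 0#
        v≈0 k = trans (eval-* (bPoly a (toℕ k)) (Δₚ^ (toℕ k) (translate (back J) x)) t)
          (0* (IsZero⇒eval≈0 (bPoly a (toℕ k)) (zeros (toℕ k) (Finₚ.toℕ<n k)) t))

    -- The maximum is attained as `d₀ - k₀`, and these two naturals serve as `d` and `e` in
    -- `bound-adjoint`.
    adjoint-degree : ∀ {J} (a : Op J) {D} → HasOpDegree a D → ∀ s {d} →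
      HasDegree (adjoint a (mono s)) d → + d ℤ.≤ D ℤ.+ + s
    adjoint-degree {J} a ((k₀ , d₀ , _ , _ , ≡.refl) , max) s {d} (lead , _) =
      +≤+⇒≤-+ d d₀ k₀ s (ℕₚ.≮⇒≥ λ lt → lead (bound-adjoint a b-bound (mono s) (bound-mono s) d lt))
      where
      b-bound : ∀ k → k ℕ.≤ J → DegreeBound (bPoly a k) (d₀ ℕ.+ k) k₀
      b-bound k k≤J i lt with zero-or-degree (bPoly a k)
      ... | inj₁ bk≈0             = bk≈0 i
      ... | inj₂ (e , lead , above) = above i (ℕₚ.+-cancelʳ-< k₀ e i
        (ℕₚ.≤-<-trans (-≤-⇒+≤+ e k d₀ k₀ (max k e k≤J (lead , above))) lt))

    -- Lagrange's identity

    window : Sequence → ℕ → Sequence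
    window q i n = sum {i} λ j → q (n ℕ.+ toℕ j)

    window-∷ : ∀ q i n → window q (suc i) n ≈ q n + window q i (suc n)
    window-∷ q i n = +-cong (reflexive (≡.cong q (ℕₚ.+-identityʳ n))) (sum-cong-≋ {i} shift)
      where
      shift : ∀ (j : Fin i) → q (n ℕ.+ suc (toℕ j)) ≈ q (suc n ℕ.+ toℕ j)
      shift j = reflexive (≡.cong q (ℕₚ.+-suc n (toℕ j)))

    -- The factorisation of `σ^i - 1` as `σ - 1` times `1 + σ + ... + σ^(i-1)`; the second factor is
    -- `window`.
    window-telescopes : ∀ q i n → window q i (suc n) + q n ≈ window q i n + q (n ℕ.+ i)
    window-telescopes q zero    n = +-congˡ (reflexive (≡.cong q (≡.sym (ℕₚ.+-identityʳ n))))
    window-telescopes q (suc i) n = begin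
      window q (suc i) (suc n) + q n
        ≈⟨ +-congʳ (trans (window-∷ q i (suc n)) (+-comm _ _)) ⟩
      (window q i (suc (suc n)) + q (suc n)) + q n
        ≈⟨ +-congʳ (window-telescopes q i (suc n)) ⟩
      (window q i (suc n) + q (suc n ℕ.+ i)) + q n
        ≈⟨ rearrange (window q i (suc n)) (q (suc n ℕ.+ i)) (q n) ⟩
      (q n + window q i (suc n)) + q (suc n ℕ.+ i)
        ≈⟨ +-cong (window-∷ q i n) (reflexive (≡.cong q (ℕₚ.+-suc n i))) ⟨
      window q (suc i) n + q (n ℕ.+ suc i) ∎
      where
      rearrange : ∀ w u v → (w + u) + v ≈ (v + w) + u
      rearrange = solve 3 (λ w u v → ((w :+ u) :+ v) := ((v :+ w) :+ u)) refl

    -- Summed over `i`, these give `L*(x) F` when taken at `m = n`, and `x L(F)` when taken at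
    -- `m = n + i`.
    summand : ∀ {J} → Op J → Poly → Sequence → Fin (suc J) → Sequence
    summand a x F i m = (eval (a i) (ι m + back (toℕ i)) * eval x (ι m + back (toℕ i))) * F m

    -- The boundary term of summation by parts.
    potential : ∀ {J} → Op J → Poly → Sequence → Sequence
    potential a x F n = sum λ i → window (summand a x F i) (toℕ i) n

    -- Each window trades its summand at `n` for the one at `n + i`. The former add up to `L*(x) F`,
    -- the latter to `x L(F)`, which is 0.
    lagrange : ∀ {J} (a : Op J) x F → a ∈ann F → ∀ n →
      potential a x F (suc n) + (adjoint a x ⊙ F) n ≈ potential a x F n
    lagrange {J} a x F ann n = begin
      potential a x F (suc n) + (adjoint a x ⊙ F) n
        ≈⟨ +-congˡ adjoint-part ⟩
      sum (λ i → W i (suc n)) + sum (λ i → q i n)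
        ≈⟨ ∑-distrib-+ (λ i → W i (suc n)) (λ i → q i n) ⟨
      sum (λ i → W i (suc n) + q i n)
        ≈⟨ sum-cong-≋ (λ i → window-telescopes (q i) (toℕ i) n) ⟩
      sum (λ i → W i n + q i (n ℕ.+ toℕ i))
        ≈⟨ ∑-distrib-+ (λ i → W i n) (λ i → q i (n ℕ.+ toℕ i)) ⟩
      potential a x F n + sum (λ i → q i (n ℕ.+ toℕ i))
        ≈⟨ +-congˡ annihilated ⟩
      potential a x F n + 0#
        ≈⟨ +-identityʳ _ ⟩
      potential a x F n ∎
      where
      q : Fin (suc J) → Sequence
      q = summand a x F
      W : Fin (suc J) → Sequence
      W i = window (q i) (toℕ i)
      adjoint-part : (adjoint a x ⊙ F) n ≈ sum (λ i → q i n)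
      adjoint-part = trans (*-congʳ (eval-adjoint a x (ι n))) (*-distribʳ-sum (F n)
        (λ i → eval (a i) (ι n + back (toℕ i)) * eval x (ι n + back (toℕ i))))
      T : Fin (suc J) → Carrier
      T i = eval (a i) (ι n) * F (n ℕ.+ toℕ i)
      term : ∀ i → q i (n ℕ.+ toℕ i) ≈ eval x (ι n) * T i
      term i = trans (*-congʳ (*-cong (eval-cong (a i) point) (eval-cong x point)))
                     (rearrange (eval (a i) (ι n)) (eval x (ι n)) (F (n ℕ.+ toℕ i)))
        where
        point : ι (n ℕ.+ toℕ i) + back (toℕ i) ≈ ι n
        point = trans (+-congˡ (+-identityˡ _)) (x≈z+y⇒x-y≈z (ι-+ n (toℕ i)))
        rearrange : ∀ a x f → (a * x) * f ≈ x * (a * f)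
        rearrange = solve 3 (λ a x f → ((a :* x) :* f) := (x :* (a :* f))) refl
      annihilated : sum (λ i → q i (n ℕ.+ toℕ i)) ≈ 0#
      annihilated = begin
        sum (λ i → q i (n ℕ.+ toℕ i))   ≈⟨ sum-cong-≋ term ⟩
        sum (λ i → eval x (ι n) * T i)  ≈⟨ *-distribˡ-sum (eval x (ι n)) T ⟨
        eval x (ι n) * sum T            ≈⟨ *0 (ann n) ⟩
        0#                              ∎

    -- The minimal order of a sequence

    top-index : ∀ {m} (v : Vector Poly m) → (∀ i → IsZero (v i)) ⊎
      (Σ[ i ∈ Fin m ] ¬ IsZero (v i) × (∀ j → i Fin.< j → IsZero (v j)))
    top-index {zero}  v = inj₁ λ ()
    top-index {suc m} v with top-index (v ∘ suc)
    ... | inj₂ (i , vi≉0 , above) = inj₂ (suc i , vi≉0 , λ { (suc j) (s≤s i<j) → above j i<j })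
    ... | inj₁ tail≈0 with emˡ {IsZero (v zero)}
    ...   | yes v₀≈0 = inj₁ λ { zero → v₀≈0 ; (suc i) → tail≈0 i }
    ...   | no  v₀≉0 = inj₂ (zero , v₀≉0 , λ { (suc j) _ → tail≈0 j })

    has-order : ∀ {J} (a : Op J) → ¬ IsZeroOp a → ∃[ r ] HasOrder a r
    has-order a a≉0 with top-index a
    ... | inj₁ a≈0                = contradiction a≈0 a≉0
    ... | inj₂ (i , ai≉0 , above) = toℕ i , i , ≡.refl , ai≉0 , above

    seq-order : ∀ {J} (a : Op J) G → ¬ IsZeroOp a → a ∈ann G → ∃[ r ] HasSeqOrder G r
    seq-order {J} a G a≉0 ann = proj₁ minimum , proj₁ (proj₂ minimum) ,
      λ J′ a′ s ann′ ord → ℕₚ.≮⇒≥ λ s<r → proj₂ (proj₂ minimum) s s<r (J′ , a′ , ann′ , ord)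
      where
      Attained : ℕ → Set (c ⊔ ℓ₁)
      Attained r = Σ[ J ∈ ℕ ] Σ[ a ∈ Op J ] a ∈ann G × HasOrder a r
      minimum : ∃[ r ] Attained r × (∀ s → s ℕ.< r → ¬ Attained s)
      minimum = least (lower-em {b = ℓ₂} em) {P = Attained}
        (proj₁ (has-order a a≉0) , J , a , ann , proj₂ (has-order a a≉0))

    -- Clears the denominators of ∑ₖ aₖ(n) σᵏ ∘ 1/p(n).
    rescale : ∀ {J} → Op J → Poly → Op J
    rescale a p k = a k *ₚ prodₚ (removeAt (λ j → translate (ι (toℕ j)) p) k)

    -- The factor `p(n+k)` carried by `p F` is exactly the one left out of the k-th product, so the
    -- sum is the full product times `L(F)`.
    rescale-ann : ∀ {J} (a : Op J) p F → a ∈ann F → rescale a p ∈ann (p ⊙ F)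
    rescale-ann {J} a p F ann n = begin
      apply (rescale a p) (p ⊙ F) n              ≈⟨ sum-cong-≋ term ⟩
      sum (λ k → eval (prodₚ v) (ι n) * T k)     ≈⟨ *-distribˡ-sum (eval (prodₚ v) (ι n)) T ⟨
      eval (prodₚ v) (ι n) * sum T               ≈⟨ *0 (ann n) ⟩
      0#                                         ∎
      where
      v : Vector Poly (suc J)
      v j = translate (ι (toℕ j)) p
      T : Fin (suc J) → Carrier
      T k = eval (a k) (ι n) * F (n ℕ.+ toℕ k)
      term : ∀ k → eval (rescale a p k) (ι n) * (eval p (ι (n ℕ.+ toℕ k)) * F (n ℕ.+ toℕ k)) ≈
                   eval (prodₚ v) (ι n) * T k
      term k = begin
        eval (rescale a p k) (ι n) * (eval p (ι (n ℕ.+ toℕ k)) * f)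
          ≈⟨ *-cong (eval-* (a k) (prodₚ (removeAt v k)) (ι n))
               (*-congʳ (trans (eval-cong p (ι-+ n (toℕ k))) (sym (eval-translate (ι (toℕ k)) p (ι n))))) ⟩
        (A * P) * (V * f)
          ≈⟨ rearrange A P V f ⟩
        (V * P) * (A * f)
          ≈⟨ *-congʳ (eval-prod-remove v k (ι n)) ⟨
        eval (prodₚ v) (ι n) * T k ∎
        where
        f = F (n ℕ.+ toℕ k)
        A = eval (a k) (ι n)
        P = eval (prodₚ (removeAt v k)) (ι n)
        V = eval (v k) (ι n)
        rearrange : ∀ A P V f → (A * P) * (V * f) ≈ (V * P) * (A * f)
        rearrange = solve 4 (λ A P V f → ((A :* P) :* (V :* f)) := ((V :* P) :* (A :* f))) refl

    rescale-≉0 : ∀ {J} (a : Op J) p → ¬ IsZeroOp a → ¬ IsZero p → ¬ IsZeroOp (rescale a p)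
    rescale-≉0 a p a≉0 p≉0 b≈0 with has-order a a≉0
    ... | _ , i , _ , ai≉0 , _ = *ₚ-≉0 (a i) (prodₚ (removeAt v i)) ai≉0
      (prodₚ-≉0 (removeAt v i) λ k → translate-≉0 (ι (toℕ (punchIn i k))) p p≉0) (b≈0 i)
      where v = λ j → translate (ι (toℕ j)) p

    -- Rational combinations of shifts

    module Span (G : Sequence) (r : ℕ) where

      -- S agrees for large n with a combination of G(n), …, G(n+r-1) over K(n); d is a
      -- common denominator.
      Spanned : Sequence → Set (c ⊔ ℓ₁)
      Spanned S = Σ[ d ∈ Poly ] ¬ IsZero d × (Σ[ w ∈ Vector Poly r ] Σ[ N ∈ ℕ ] (∀ n → N ℕ.≤ n →
        eval d (ι n) * S n ≈ sum λ i → eval (w i) (ι n) * G (n ℕ.+ toℕ i)))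

      spanned-cong : ∀ {S S′} → (∀ n → S n ≈ S′ n) → Spanned S → Spanned S′
      spanned-cong S≈S′ (d , d≉0 , w , N , eq) =
        d , d≉0 , w , N , λ n N≤n → trans (*-congˡ (sym (S≈S′ n))) (eq n N≤n)

      spanned-0 : Spanned (λ _ → 0#)
      spanned-0 = 1# ∷ [] , 1ₚ≉0 , (λ _ → []) , 0 , λ n _ →
        trans (zeroʳ _) (sym (sum-zero {r} {λ i → 0# * G (n ℕ.+ toℕ i)} λ i → zeroˡ _))

      spanned-+ : ∀ {S S′} → Spanned S → Spanned S′ → Spanned (λ n → S n + S′ n)
      spanned-+ {S} {S′} (d , d≉0 , w , N , eq) (d′ , d′≉0 , w′ , N′ , eq′) =
        d *ₚ d′ , *ₚ-≉0 d d′ d≉0 d′≉0 , (λ i → d′ *ₚ w i +ₚ d *ₚ w′ i) , N ℕ.⊔ N′ , λ n le →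
        let D = eval d (ι n)
            D′ = eval d′ (ι n)
            f  = λ i → eval (w i) (ι n) * G (n ℕ.+ toℕ i)
            f′ = λ i → eval (w′ i) (ι n) * G (n ℕ.+ toℕ i)
            term : ∀ i → D′ * f i + D * f′ i ≈ eval (d′ *ₚ w i +ₚ d *ₚ w′ i) (ι n) * G (n ℕ.+ toℕ i)
            term i = trans
              (distribute D′ (eval (w i) (ι n)) D (eval (w′ i) (ι n)) (G (n ℕ.+ toℕ i)))
              (*-congʳ (sym (trans (eval-+ (d′ *ₚ w i) (d *ₚ w′ i) (ι n))
                (+-cong (eval-* d′ (w i) (ι n)) (eval-* d (w′ i) (ι n))))))
        in begin
          eval (d *ₚ d′) (ι n) * (S n + S′ n)
            ≈⟨ *-congʳ (eval-* d d′ (ι n)) ⟩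
          (D * D′) * (S n + S′ n)
            ≈⟨ separate D D′ (S n) (S′ n) ⟩
          D′ * (D * S n) + D * (D′ * S′ n)
            ≈⟨ +-cong (*-congˡ (eq n (ℕₚ.m⊔n≤o⇒m≤o N N′ le))) (*-congˡ (eq′ n (ℕₚ.m⊔n≤o⇒n≤o N N′ le))) ⟩
          D′ * sum f + D * sum f′
            ≈⟨ +-cong (*-distribˡ-sum D′ f) (*-distribˡ-sum D f′) ⟩
          sum (λ i → D′ * f i) + sum (λ i → D * f′ i)
            ≈⟨ ∑-distrib-+ (λ i → D′ * f i) (λ i → D * f′ i) ⟨
          sum (λ i → D′ * f i + D * f′ i)
            ≈⟨ sum-cong-≋ term ⟩
          sum (λ i → eval (d′ *ₚ w i +ₚ d *ₚ w′ i) (ι n) * G (n ℕ.+ toℕ i)) ∎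
        where
        separate : ∀ D D′ s s′ → (D * D′) * (s + s′) ≈ D′ * (D * s) + D * (D′ * s′)
        separate = solve 4 (λ D D′ s s′ →
          ((D :* D′) :* (s :+ s′)) := (D′ :* (D :* s) :+ D :* (D′ :* s′))) refl
        distribute : ∀ D′ w D w′ g → D′ * (w * g) + D * (w′ * g) ≈ (D′ * w + D * w′) * g
        distribute = solve 5 (λ D′ w D w′ g →
          (D′ :* (w :* g) :+ D :* (w′ :* g)) := ((D′ :* w :+ D :* w′) :* g)) refl

      spanned-⊙ : ∀ h {S} → Spanned S → Spanned (h ⊙ S)
      spanned-⊙ h {S} (d , d≉0 , w , N , eq) = d , d≉0 , (λ i → h *ₚ w i) , N , λ n N≤n →
        let H = eval h (ι n)
            f = λ i → eval (w i) (ι n) * G (n ℕ.+ toℕ i)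
            term : ∀ i → H * f i ≈ eval (h *ₚ w i) (ι n) * G (n ℕ.+ toℕ i)
            term i = trans (sym (*-assoc H _ _)) (*-congʳ (sym (eval-* h (w i) (ι n))))
        in begin
          eval d (ι n) * (H * S n)    ≈⟨ x∙yz≈y∙xz (eval d (ι n)) H (S n) ⟩
          H * (eval d (ι n) * S n)    ≈⟨ *-congˡ (eq n N≤n) ⟩
          H * sum f                   ≈⟨ *-distribˡ-sum H f ⟩
          sum (λ i → H * f i)         ≈⟨ sum-cong-≋ term ⟩
          sum (λ i → eval (h *ₚ w i) (ι n) * G (n ℕ.+ toℕ i)) ∎

      -- The divisor is absorbed into the common denominator.
      spanned-divide : ∀ h {S} → ¬ IsZero h → Spanned (h ⊙ S) → Spanned S
      spanned-divide h {S} h≉0 (d , d≉0 , w , N , eq) = d *ₚ h , *ₚ-≉0 d h d≉0 h≉0 , w , N ,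
        λ n N≤n → trans (trans (*-congʳ (eval-* d h (ι n))) (*-assoc _ _ (S n))) (eq n N≤n)

      spanned-sum : ∀ {m} (S : Fin m → Sequence) → (∀ i → Spanned (S i)) →
                    Spanned (λ n → sum λ i → S i n)
      spanned-sum {zero}  S sp = spanned-0
      spanned-sum {suc m} S sp = spanned-+ (sp zero) (spanned-sum (S ∘ suc) (sp ∘ suc))

      spanned-neg : ∀ {S} → Spanned S → Spanned (λ n → - S n)
      spanned-neg {S} sp = spanned-cong
        (λ n → trans (*-congʳ (eval-const (- 1#) (ι n))) (-1*x≈-x (S n)))
        (spanned-⊙ (- 1# ∷ []) sp)

      unit : ∀ {m} → Fin m → Vector Poly m
      unit zero    zero    = 1# ∷ []
      unit zero    (suc j) = []
      unit (suc i) zero    = []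
      unit (suc i) (suc j) = unit i j

      sum-unit : ∀ {m} (i : Fin m) x (t : Vector Carrier m) → sum (λ j → eval (unit i j) x * t j) ≈ t i
      sum-unit {suc m} zero x t = begin
        eval (1# ∷ []) x * t zero + sum {m} (λ j → 0# * t (suc j))
          ≈⟨ +-cong (trans (*-congʳ (eval-const 1# x)) (*-identityˡ _))
                    (sum-zero {m} {λ j → 0# * t (suc j)} λ j → zeroˡ _) ⟩
        t zero + 0#
          ≈⟨ +-identityʳ _ ⟩
        t zero ∎
      sum-unit (suc i) x t =
        trans (+-cong (zeroˡ _) (sum-unit i x (t ∘ suc))) (+-identityˡ _)

      spanned-basis : ∀ (i : Fin r) → Spanned (λ n → G (n ℕ.+ toℕ i))
      spanned-basis i = 1# ∷ [] , 1ₚ≉0 , unit i , 0 , λ n _ →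
        trans (trans (*-congʳ (eval-const 1# (ι n))) (*-identityˡ _))
              (sym (sum-unit i (ι n) (λ j → G (n ℕ.+ toℕ j))))

      -- Solve the recurrence for its leading term.
      spanned-shift : ∀ {J} (a : Op J) → a ∈ann G → HasOrder a r → ∀ j → Spanned (λ n → G (n ℕ.+ j))
      spanned-shift {J} a ann (i , i≡r , ai≉0 , above) = <-rec _ step
        where
        step : ∀ j → (∀ {k} → k ℕ.< j → Spanned (λ n → G (n ℕ.+ k))) → Spanned (λ n → G (n ℕ.+ j))
        step j rec with j ℕₚ.<? r
        ... | yes j<r = ≡.subst (λ k → Spanned (λ n → G (n ℕ.+ k))) (Finₚ.toℕ-fromℕ< j<r)
                          (spanned-basis (Fin.fromℕ< j<r))
        ... | no  j≮r = spanned-divide (translate (ι t) (a i)) (translate-≉0 (ι t) (a i) ai≉0)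
            (spanned-cong leading (spanned-neg (spanned-sum rest λ k →
              spanned-term (punchIn i k) (Finₚ.punchInᵢ≢i i k))))
          where
          -- The recurrence is used at `n + t`, where its leading term is a multiple of `G (n + j)`
          -- because the leading index is `r`.
          t = j ℕ.∸ r
          t+i≡j : t ℕ.+ toℕ i ≡ j
          t+i≡j = ≡.trans (≡.cong (t ℕ.+_) i≡r) (ℕₚ.m∸n+n≡m (ℕₚ.≮⇒≥ j≮r))
          term : Fin (suc J) → Sequence
          term k n = eval (a k) (ι (n ℕ.+ t)) * G (n ℕ.+ t ℕ.+ toℕ k)
          rest : Fin J → Sequence
          rest k = term (punchIn i k)

          translated : ∀ k n → eval (translate (ι t) (a k)) (ι n) * G (n ℕ.+ (t ℕ.+ toℕ k)) ≈ term k n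
          translated k n = *-cong
            (trans (eval-translate (ι t) (a k) (ι n)) (eval-cong (a k) (sym (ι-+ n t))))
            (reflexive (≡.cong G (≡.sym (ℕₚ.+-assoc n t (toℕ k)))))

          spanned-term : ∀ k → ¬ k ≡ i → Spanned (term k)
          spanned-term k k≢i with Finₚ.<-cmp k i
          ... | tri≈ _ k≡i _ = contradiction k≡i k≢i
          -- Coefficients above the order are zero.
          ... | tri> _ _ i<k = spanned-cong
            (λ n → sym (0* (IsZero⇒eval≈0 (a k) (above k i<k) (ι (n ℕ.+ t))))) spanned-0
          -- Lower terms involve shifts by `t + k`, which is below `j`, so induction applies.
          ... | tri< k<i _ _ = spanned-cong (translated k) (spanned-⊙ (translate (ι t) (a k))
            (rec (≡.subst (t ℕ.+ toℕ k ℕ.<_) t+i≡j (ℕₚ.+-monoʳ-< t k<i))))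

          leading : ∀ n → - sum (λ k → rest k n) ≈
                          eval (translate (ι t) (a i)) (ι n) * G (n ℕ.+ j)
          leading n = begin
            - sum (λ k → rest k n)
              ≈⟨ +-identityˡ _ ⟨
            0# - sum (λ k → rest k n)
              ≈⟨ x≈z+y⇒x-y≈z (trans (sym (ann (n ℕ.+ t))) (sum-remove {i = i} (λ k → term k n))) ⟩
            term i n
              ≈⟨ translated i n ⟨
            eval (translate (ι t) (a i)) (ι n) * G (n ℕ.+ (t ℕ.+ toℕ i))
              ≈⟨ *-congˡ (reflexive (≡.cong (λ k → G (n ℕ.+ k)) t+i≡j)) ⟩
            eval (translate (ι t) (a i)) (ι n) * G (n ℕ.+ j) ∎

      spanned⇒summable : HasSeqOrder G r → ∀ {S} → Spanned S →
        (∀ n → G n ≈ S (suc n) - S n) → IsSummable G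
      spanned⇒summable order {S} (d , d≉0 , w , N , eq) G≈ΔS
        with eventually-nonzero d d≉0
      -- Beyond `M` the denominator has no natural root, so there are no poles; beyond `N` the
      -- combination represents `S`.
      ... | M , d-nz = r , order , u , N ℕ.⊔ M , def , λ n le le′ →
        trans (G≈ΔS n) (sym (+-cong (value (suc n) le′) (-‿cong (value n le))))
        where
        u : Vector RatFun r
        u i = record { num = w i ; den = d ; den≉0 = d≉0 }
        d#0 : ∀ n → N ℕ.⊔ M ℕ.≤ n → eval d (ι n) # 0#
        d#0 n le = ≉0⇒#0 (d-nz n (ℕₚ.m⊔n≤o⇒n≤o N M le))
        def : ∀ n → N ℕ.⊔ M ℕ.≤ n → ∀ i → DefinedAt (u i) (ι n)
        def n le i = d#0 n le
        value : ∀ n le → sum (λ i → valueAt (u i) (ι n) (def n le i) * G (n ℕ.+ toℕ i)) ≈ S n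
        value n le = begin
          sum (λ i → valueAt (u i) (ι n) (def n le i) * G (n ℕ.+ toℕ i))  ≈⟨ sum-cong-≋ term ⟩
          sum (λ i → d⁻¹ * f i)           ≈⟨ *-distribˡ-sum d⁻¹ f ⟨
          d⁻¹ * sum f                     ≈⟨ *-congˡ (eq n (ℕₚ.m⊔n≤o⇒m≤o N M le)) ⟨
          d⁻¹ * (eval d (ι n) * S n)      ≈⟨ *-assoc _ _ _ ⟨
          (d⁻¹ * eval d (ι n)) * S n      ≈⟨ *-congʳ (inverseˡ (d#0 n le)) ⟩
          1# * S n                        ≈⟨ *-identityˡ _ ⟩
          S n                             ∎
          where
          d⁻¹ = proj₁ (#⇒invertible (d#0 n le))
          f : Fin r → Carrier
          f i = eval (w i) (ι n) * G (n ℕ.+ toℕ i)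
          term : ∀ i → (eval (w i) (ι n) * d⁻¹) * G (n ℕ.+ toℕ i) ≈ d⁻¹ * f i
          term i = trans (*-congʳ (*-comm _ d⁻¹)) (*-assoc d⁻¹ _ _)

      spanned-potential : ∀ {J} (a : Op J) x F → (∀ j → Spanned (λ n → F (n ℕ.+ j))) →
                          Spanned (potential a x F)
      spanned-potential {J} a x F spanned-F =
        spanned-sum (λ i → window (summand a x F i) (toℕ i)) λ i →
          spanned-sum {toℕ i} (λ j n → summand a x F i (n ℕ.+ toℕ j)) λ j → spanned-summand i (toℕ j)
        where
        spanned-summand : ∀ i j → Spanned (λ n → summand a x F i (n ℕ.+ j))
        spanned-summand i j = spanned-cong
          (λ n → *-congʳ (trans (eval-* (T (a i)) (T x) (ι n)) (*-cong (point (a i) n) (point x n))))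
          (spanned-⊙ (T (a i) *ₚ T x) (spanned-F j))
          where
          T : Poly → Poly
          -- At index `n + j` the coefficients are taken at `n + j - i`, hence are polynomials in
          -- `n`.
          T = translate (ι j + back (toℕ i))
          point : ∀ h n → eval (T h) (ι n) ≈ eval h (ι (n ℕ.+ j) + back (toℕ i))
          point h n = trans (eval-translate (ι j + back (toℕ i)) h (ι n))
            (eval-cong h (trans (sym (+-assoc (ι n) (ι j) (back (toℕ i)))) (+-congʳ (sym (ι-+ n j)))))

    -- Lagrange's identity presents `p F` as minus the difference of the potential, so the potential
    -- has to be negated.
    t′+g≈t⇒g≈-t′--t : ∀ {t′ g t} → t′ + g ≈ t → g ≈ - t′ - (- t)
    t′+g≈t⇒g≈-t′--t {t′} {g} {t} eq = sym (x≈z+y⇒x-y≈z (∙-cancelˡ (t′ + t) _ _ (begin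
      (t′ + t) + - t′         ≈⟨ rearrange₁ t′ t (- t′) ⟩
      (t′ + - t′) + t         ≈⟨ +-congʳ (-‿inverseʳ t′) ⟩
      0# + t                  ≈⟨ +-identityˡ t ⟩
      t                       ≈⟨ eq ⟨
      t′ + g                  ≈⟨ +-identityʳ _ ⟨
      (t′ + g) + 0#           ≈⟨ +-congˡ (-‿inverseʳ t) ⟨
      (t′ + g) + (t + - t)    ≈⟨ rearrange₂ t′ g t (- t) ⟩
      (t′ + t) + (g + - t)    ∎)))
      where
      rearrange₁ : ∀ u v w → (u + v) + w ≈ (u + w) + v
      rearrange₁ = solve 3 (λ u v w → ((u :+ v) :+ w) := ((u :+ w) :+ v)) refl
      rearrange₂ : ∀ u g v w → (u + g) + (v + w) ≈ (u + v) + (g + w)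
      rearrange₂ = solve 4 (λ u g v w → ((u :+ g) :+ (v :+ w)) := ((u :+ v) :+ (g :+ w))) refl

    potential⇒summable : ∀ {J} (a : Op J) x F p → ¬ IsZeroOp a → a ∈ann F → ¬ IsZero p →
      (∀ n → potential a x F (suc n) + (p ⊙ F) n ≈ potential a x F n) → IsSummable (p ⊙ F)
    potential⇒summable a x F p a≉0 ann p≉0 identity =
      summable (seq-order (rescale a p) (p ⊙ F) (rescale-≉0 a p a≉0 p≉0) (rescale-ann a p F ann))
      where
      summable : (∃[ r ] HasSeqOrder (p ⊙ F) r) → IsSummable (p ⊙ F)
      summable (r , order@((_ , m , m-ann , m-order) , _)) =
        spanned⇒summable order {λ n → - potential a x F n}
          (spanned-neg (spanned-potential a x F spanned-F)) (λ n → t′+g≈t⇒g≈-t′--t (identity n))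
        where
        open Span (p ⊙ F) r
        spanned-F : ∀ j → Spanned (λ n → F (n ℕ.+ j))
        -- `F (n + j)` is the shift of `p F` by `j` divided by `p(n + j)`, and every shift of `p F`
        -- reduces to the first `r`.
        spanned-F j = spanned-divide (translate (ι j) p) (translate-≉0 (ι j) p p≉0)
          (spanned-cong (λ n → *-congʳ (trans (eval-cong p (ι-+ n j)) (sym (eval-translate (ι j) p (ι n)))))
            (spanned-shift m m-ann m-order j))

theorem2p1 : {c ℓ₁ ℓ₂ : Level} → ExcludedMiddle (c ⊔ ℓ₁ ⊔ ℓ₂) →
    (K : HeytingField c ℓ₁ ℓ₂) → let open Holonomic K in
    CharacteristicZero →
    (F : Sequence) → IsHolonomic F →
    (J : ℕ) (L : Op J) → ¬ IsZeroOp L → L ∈ann F →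
    Σ[ degL ∈ ℤ ] Σ[ C-L ∈ ℕ ] HasOpDegree L degL × HasContinuedZeroIndex L C-L ×
    (Σ[ p ∈ Poly ] ¬ IsZero p × IsSummable (p ⊙ F) ×
    (Σ[ degp ∈ ℕ ] HasDegree p degp × + degp ℤ.≤ degL ℤ.+ + C-L))
theorem2p1 em K char0 F _ J L L≉0 ann = result (op-degree L L≉0) (continued-zero-index L L≉0)
  where
  open Holonomic K
  open Polynomials K
  open Classical em char0

  result : (∃[ D ] HasOpDegree L D) → (∃[ s ] HasContinuedZeroIndex L s) →
    Σ[ degL ∈ ℤ ] Σ[ C-L ∈ ℕ ] HasOpDegree L degL × HasContinuedZeroIndex L C-L ×
    (Σ[ p ∈ Poly ] ¬ IsZero p × IsSummable (p ⊙ F) ×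
    (Σ[ degp ∈ ℕ ] HasDegree p degp × + degp ℤ.≤ degL ℤ.+ + C-L))
  result (D , degree) (s , index@(p≉0 , _)) with zero-or-degree (adjoint L (mono s))
  ... | inj₁ p≈0 = contradiction p≈0 p≉0
  ... | inj₂ (d , deg-p) = D , s , degree , index , adjoint L (mono s) , p≉0 ,
    potential⇒summable L (mono s) F (adjoint L (mono s)) L≉0 ann p≉0 (lagrange L (mono s) F ann) , d , deg-p , adjoint-degree L degree s deg-p
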